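{- An injective map $f:X\to X$ is unary FA-presentable if and only if (1) there is a bound on the size of its finite orbits and every finite orbit is a directed cycle, and (2) there are finitely many infinite orbits, each being either an outward infinite path or a bi-infinite path. A partial injective map $f$ from $X$ to itself is unary FA-presentable if and only if (3) there is a bound on the size of its finite orbits and every finite orbit is a directed cycle or a finite directed path, and (4) there are finitely many infinite orbits, each being an outward infinite path, an inward infinite path, or a bi-infinite path.
   Context: The graph of a partial map $f:X\to X$ has vertex set $X$ and edges $(x,(x)f)$ whenever $(x)f$ is defined; orbits are the connected components of this graph, and statements about the shape of an orbit refer to this graph. An outward infinite path has vertices $v_0,v_1,\dots$ and edges $(v_i,v_{i+1})$; an inward infinite path has vertices $v_0,v_1,\dots$ and edges $(v_{i+1},v_i)$; a bi-infinite path has vertices $v_i$, $i\in\mathbb{Z}$, and edges $(v_i,v_{i+1})$. $(X,f)$ is unary FA-presentable if there exist a regular language $L\subseteq a^*$ and a surjection $\phi:L\to X$ such that $\{(u,v)\in L^2:u\phi=v\phi\}$ and $\{(u,v)\in L^2:(u\phi)f=v\phi\}$ are regular relations (words $\mathrm{conv}(u,v)$ over $\{a,\$\}^2$, reading $u,v$ in parallel with the shorter padded by $\$$, form regular languages).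
   Formalization: The set X is assumed countable; without this the "if" directions fail, since the identity map on an uncountable set satisfies (1)–(4) but is not unary FA-presentable, a presentable X being the image of a subset of a*. -}

module Defs where

open import Data.Fin.Base using (Fin; toℕ)
open import Data.Fin.Subset using (Subset; _∈_)
open import Data.Integer.Base as ℤ using (ℤ)
open import Data.List.Base using (List; []; _∷_; foldl)
open import Data.List.Relation.Unary.Any using (Any)
open import Data.Maybe.Base using (Maybe; just; nothing)
open import Data.Nat.Base using (ℕ; suc; _≤_)
open import Data.Nat.DivMod using (_%_)
open import Data.Product.Base using (_×_; _,_; Σ-syntax; ∃-syntax)
open import Data.Sum.Base using (_⊎_)
open import Function.Bundles using (_⇔_)
open import Function.Definitions using (Injective)
open import Level using (0ℓ)
open import Relation.Binary.Construct.Closure.Equivalence using (EqClosure)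
open import Relation.Binary.Core using (Rel)
open import Relation.Binary.PropositionalEquality using (_≡_)
open import Relation.Nullary.Negation using (¬_)
open import Relation.Unary using (Pred)

record DFA (A : Set) : Set where
  field
    states : ℕ
    start  : Fin states
    step   : Fin states → A → Fin states
    final  : Subset states

  Accepts : Pred (List A) 0ℓ
  Accepts w = foldl step start w ∈ final

Regular : {A : Set} → Pred (List A) 0ℓ → Set
Regular {A} L = Σ[ M ∈ DFA A ] (∀ w → L w ⇔ DFA.Accepts M w)

data Letter : Set where
  a : Letter

Word : Set
Word = List Letter

-- In Maybe A, the element nothing plays the role of the padding symbol $.
conv : {A : Set} → List A → List A → List (Maybe A × Maybe A)
conv []       []       = []
conv []       (y ∷ ys) = (nothing , just y) ∷ conv [] ys
conv (x ∷ xs) []       = (just x , nothing) ∷ conv xs []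
conv (x ∷ xs) (y ∷ ys) = (just x , just y) ∷ conv xs ys

RegularRelation : {A : Set} → Rel (List A) 0ℓ → Set
RegularRelation R = Regular (λ w → ∃[ u ] ∃[ v ] (R u v × w ≡ conv u v))

record Enumerates {X V : Set} (vertex : V → X) (C : Pred X 0ℓ) : Set where
  field
    injective : Injective _≡_ _≡_ vertex
    image     : ∀ y → C y ⇔ (∃[ v ] vertex v ≡ y)

HasSize : {X : Set} → Pred X 0ℓ → ℕ → Set
HasSize {X} C n = Σ[ e ∈ (Fin n → X) ] Enumerates e C

Finite : {X : Set} → Pred X 0ℓ → Set
Finite C = ∃[ n ] HasSize C n

Infinite : {X : Set} → Pred X 0ℓ → Set
Infinite C = ¬ Finite C

-- A partial map from X to itself is a function X → Maybe X, with value nothing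
-- where it is undefined; a total map f is the partial map just ∘ f.

PartialInjective : {X : Set} → (X → Maybe X) → Set
PartialInjective f = ∀ {x y z} → f x ≡ just z → f y ≡ just z → x ≡ y

module _ {X : Set} (f : X → Maybe X) where

  Edge : Rel X 0ℓ
  Edge x y = f x ≡ just y

  -- φ takes the membership proof irrelevantly, so that it is a function on the
  -- set of words L rather than on the proofs of membership.
  record UnaryFAPresentable : Set₁ where
    field
      L            : Pred Word 0ℓ
      L-regular    : Regular L
      φ            : (u : Word) → .(L u) → X
      φ-surjective : ∀ x → ∃[ u ] Σ[ p ∈ L u ] φ u p ≡ x
      ≡-regular    : RegularRelation λ u v →
                       Σ[ p ∈ L u ] Σ[ q ∈ L v ] φ u p ≡ φ v q
      f-regular    : RegularRelation λ u v →
                       Σ[ p ∈ L u ] Σ[ q ∈ L v ] f (φ u p) ≡ just (φ v q)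

  -- The orbit of x, as a subset of X: its component in the underlying
  -- undirected graph.  Every orbit is the orbit of some x.
  Orbit : X → Pred X 0ℓ
  Orbit = EqClosure Edge

  -- The subgraph induced on C is isomorphic to the directed graph (V , _⟶_).
  HasShape : Pred X 0ℓ → (V : Set) → Rel V 0ℓ → Set
  HasShape C V _⟶_ = Σ[ vertex ∈ (V → X) ]
    (Enumerates vertex C × (∀ u v → Edge (vertex u) (vertex v) ⇔ (u ⟶ v)))

  -- The case n = 0 is a single vertex with a loop.
  IsDirectedCycle : Pred X 0ℓ → Set
  IsDirectedCycle C = ∃[ n ]
    HasShape C (Fin (suc n)) (λ i j → toℕ j ≡ suc (toℕ i) % suc n)

  -- The case n = 0 is a single vertex without edges.
  IsFiniteDirectedPath : Pred X 0ℓ → Set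
  IsFiniteDirectedPath C = ∃[ n ]
    HasShape C (Fin (suc n)) (λ i j → toℕ j ≡ suc (toℕ i))

  IsOutwardInfinitePath : Pred X 0ℓ → Set
  IsOutwardInfinitePath C = HasShape C ℕ (λ i j → j ≡ suc i)

  IsInwardInfinitePath : Pred X 0ℓ → Set
  IsInwardInfinitePath C = HasShape C ℕ (λ i j → i ≡ suc j)

  IsBiInfinitePath : Pred X 0ℓ → Set
  IsBiInfinitePath C = HasShape C ℤ (λ i j → j ≡ ℤ.suc i)

  FiniteOrbitsBounded : Set
  FiniteOrbitsBounded = ∃[ N ] (∀ x n → HasSize (Orbit x) n → n ≤ N)

  -- Orbits are counted through representatives: finitely many points suffice
  -- to meet every infinite orbit.
  FinitelyManyInfiniteOrbits : Set
  FinitelyManyInfiniteOrbits =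
    Σ[ xs ∈ List X ] (∀ x → Infinite (Orbit x) → Any (Orbit x) xs)

  Condition1 : Set
  Condition1 = FiniteOrbitsBounded ×
    (∀ x → Finite (Orbit x) → IsDirectedCycle (Orbit x))

  Condition2 : Set
  Condition2 = FinitelyManyInfiniteOrbits ×
    (∀ x → Infinite (Orbit x) →
      IsOutwardInfinitePath (Orbit x) ⊎ IsBiInfinitePath (Orbit x))

  Condition3 : Set
  Condition3 = FiniteOrbitsBounded ×
    (∀ x → Finite (Orbit x) →
      IsDirectedCycle (Orbit x) ⊎ IsFiniteDirectedPath (Orbit x))

  Condition4 : Set
  Condition4 = FinitelyManyInfiniteOrbits ×
    (∀ x → Infinite (Orbit x) →
      IsOutwardInfinitePath (Orbit x) ⊎
      IsInwardInfinitePath (Orbit x) ⊎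
      IsBiInfinitePath (Orbit x))

{-# OPTIONS --safe #-}
module Submission where

open import Algebra.Properties.CommutativeSemigroup using (x∙yz≈y∙xz)
open import Axiom.ExcludedMiddle using (ExcludedMiddle)
open import Data.Bool.Base using (true)
open import Data.Empty using (⊥; ⊥-elim; ⊥-elim-irr)
import Data.Fin.Base as Fin
open import Data.Fin.Base using (Fin; zero; suc; toℕ; fromℕ; fromℕ<; inject₁; inject≤; combine; splitAt; _↑ˡ_; _↑ʳ_)
open import Data.Fin.Patterns using (0F; 1F; 2F; 3F)
import Data.Fin.Properties as Fin
open import Data.Fin.Properties using (pigeonhole; injective⇒≤; combine-injective; toℕ-combine; toℕ<n; toℕ≤pred[n]; toℕ-injective; toℕ-fromℕ; toℕ-fromℕ<; fromℕ<-injective; toℕ-inject₁; toℕ-inject≤; inject≤-injective; splitAt-↑ˡ; splitAt-↑ʳ)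
open import Data.Fin.Subset as Subset using ()
open import Data.Integer.Base as ℤ using (ℤ; -[1+_]) renaming (+_ to pos)
import Data.Integer.Properties as ℤ
open import Data.List.Base using (List; []; _∷_; foldl; length; mapMaybe; replicate; tabulate)
open import Data.List.Membership.Propositional using (_∈_; find)
open import Data.List.Membership.Propositional.Properties using (∈-tabulate⁺)
open import Data.List.Properties using (length-replicate)
open import Data.List.Relation.Unary.Any using (here; there)
open import Data.List.Relation.Unary.Any.Properties using (tabulate⁺)
open import Data.Maybe.Base using (Maybe; just; nothing; fromMaybe)
open import Data.Maybe.Properties using (just-injective)
open import Data.Nat.Base
open import Data.Nat.DivMod using (_%_; _/_; _mod_; m%n<n; m<n⇒m%n≡m; n%n≡0; m≡m%n+[m/n]*n; [m+kn]%n≡m%n; m*n/n≡m; +-distrib-/-∣ˡ; /-monoˡ-≤; m<n⇒m/n≡0)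
open import Data.Nat.Divisibility using (_∣_; divides; divides-refl; ∣-trans; m∣m*n; m≤n⇒m!∣n!)
open import Data.Nat.GeneralisedArithmetic using (fold; fold-+; iterate)
open import Data.Nat.Induction using (<-rec)
open import Data.Nat.Properties
open import Data.Product.Base using (_×_; _,_; proj₁; proj₂; ∃; ∃-syntax; Σ-syntax)
open import Data.Sum.Base using (_⊎_; inj₁; inj₂; [_,_]′)
open import Data.Unit.Base using (⊤; tt)
import Data.Vec.Base as Vec
open import Data.Vec.Functional as Vector using ()
open import Data.Vec.Properties using (lookup∘tabulate; lookup⇒[]=; []=⇒lookup)
open import Function.Base using (_∘_; _$_; flip)
open import Function.Bundles using (_⇔_; _↣_; mk⇔; Equivalence; Injection)
open import Function.Definitions using (Injective)
open import Function.Properties.Equivalence using (⇔-isEquivalence)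
open import Level using (0ℓ)
open import Relation.Binary.Construct.Closure.Equivalence using (EqClosure; symmetric; gmap)
open import Relation.Binary.Construct.Closure.ReflexiveTransitive using (ε; _◅_; _◅◅_)
open import Relation.Binary.Construct.Closure.Symmetric using (SymClosure; fwd; bwd)
open import Relation.Binary.Core using (Rel)
open import Relation.Binary.Definitions using (tri<; tri≈; tri>)
open import Relation.Binary.PropositionalEquality
open import Relation.Binary.Structures using (module IsEquivalence)
open import Relation.Nullary using (¬_; Dec; yes; no; does; contradiction)
open import Relation.Nullary.Decidable using (decidable-stable)
open import Relation.Unary using (Pred)
open import Defs

-- Code a^n by n.  A relation on a* is regular exactly if, beyond some p, it is
-- invariant under translation by p along the diagonal and under lengthening the
-- longer of two words by p whenever their lengths already differ by at least p.
--
-- In a presentation, give every point its shortest word.  An edge then joins words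
-- whose lengths differ by less than 2p, since otherwise shortening the longer one
-- would name the same point.  So every infinite orbit meets every late window
-- of 2p consecutive lengths, and there are at most 2p infinite orbits.  A connected
-- piece of a finite orbit whose lengths are all at least p has pairwise
-- incongruent lengths mod p: otherwise translating the connection would produce
-- infinitely many points of the orbit.  Hence among any p + 1 consecutive points of
-- a finite orbit there is one of the fewer than p + 1 points of length below p,
-- which bounds the orbit by (p + 1)².
--
-- Conversely, lay the points out in finitely many copies of ℕ (threads) and
-- interleave them: an infinite path needs one or two threads, infinitely many
-- finite orbits of one shape need one thread per vertex, and a finite orbit can be
-- spread over constant threads, because words may denote the same point.
--
-- The shapes of the orbits follow from injectivity alone.

open Equivalence using (to; from)
open IsEquivalence (⇔-isEquivalence {0ℓ}) using () renaming (refl to ⇔-refl; sym to ⇔-sym; trans to ⇔-trans)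

≡⇒⇔ : {A B : Set} → A ≡ B → A ⇔ B
≡⇒⇔ refl = ⇔-refl

-- The fields mirror the loops of an automaton reading a convolution: on paired letters, and on the
-- padded tail of either word. A single number can serve as both period and threshold, because a
-- period may be replaced by any multiple of it.
record Periodic (p : ℕ) (R : Rel ℕ 0ℓ) : Set where
  field
    diagonal : ∀ {m n} → p ≤ m → p ≤ n → R m n ⇔ R (p + m) (p + n)
    right    : ∀ {m n} → p + m ≤ n → R m n ⇔ R m (p + n)
    left     : ∀ {m n} → p + n ≤ m → R m n ⇔ R (p + m) n

Periodic-resp-⇔ : ∀ {p R S} → (∀ m n → S m n ⇔ R m n) → Periodic p R → Periodic p S
Periodic-resp-⇔ S⇔R per = record
  { diagonal = λ i j → ⇔-trans (S⇔R _ _) (⇔-trans (diagonal i j) (⇔-sym (S⇔R _ _)))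
  ; right    = λ i → ⇔-trans (S⇔R _ _) (⇔-trans (right i) (⇔-sym (S⇔R _ _)))
  ; left     = λ i → ⇔-trans (S⇔R _ _) (⇔-trans (left i) (⇔-sym (S⇔R _ _)))
  }
  where open Periodic per

-- Regular relations on a* are periodic

iterate-+ : {A : Set} (g : A → A) (x : A) (m n : ℕ) →
            iterate g x (m + n) ≡ iterate g (iterate g x m) n
iterate-+ g x zero    n = refl
iterate-+ g x (suc m) n = iterate-+ g (g x) m n

iterate-loop : {A : Set} (g : A → A) (x : A) (e : ℕ) → iterate g x e ≡ x →
               ∀ t → iterate g x (t * e) ≡ x
iterate-loop g x e loop zero    = refl
iterate-loop g x e loop (suc t) = begin
  iterate g x (e + t * e)             ≡⟨ iterate-+ g x e (t * e) ⟩
  iterate g (iterate g x e) (t * e)   ≡⟨ cong (λ y → iterate g y (t * e)) loop ⟩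
  iterate g x (t * e)                 ≡⟨ iterate-loop g x e loop t ⟩
  x                                   ∎
  where open ≡-Reasoning

m∣n! : ∀ {m n} → 1 ≤ m → m ≤ n → m ∣ n !
m∣n! {suc m} _ m≤n = ∣-trans (m∣m*n (m !)) (m≤n⇒m!∣n! m≤n)

n≤n! : ∀ n → n ≤ n !
n≤n! zero    = z≤n
n≤n! (suc n) = m≤m*n (suc n) (n !) {{n !≢0}}

-- Two of the first s + 1 iterates coincide, so the orbit of x enters a cycle of some length e at an
-- index i, both at most N. Since i ≤ N ≤ N! and e divides N!, a further N! steps only go round the
-- cycle. The slack between s and N lets several automata share one period.
iterate-idempotent : ∀ {s N} → s ≤ N → (g : Fin s → Fin s) (x : Fin s) →
                     iterate g x (N ! + N !) ≡ iterate g x (N !)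
iterate-idempotent {s} {N} s≤N g x
  with i , j , i<j , eq ← pigeonhole (n<1+n s) (iterate g x ∘ toℕ)
  with e , i+e≡j ← m≤n⇒∃[o]m+o≡n (<⇒≤ i<j)
  with r , i+r≡N! ← m≤n⇒∃[o]m+o≡n (≤-trans (≤-trans (s≤s⁻¹ (toℕ<n i)) s≤N) (n≤n! N))
  with divides t N!≡t*e ← m∣n! {e} {N}
         (+-cancelˡ-≤ (toℕ i) 1 e (subst₂ _≤_ (+-comm 1 (toℕ i)) (sym i+e≡j) i<j))
         (≤-trans (m≤n+m e (toℕ i)) (≤-trans (≤-reflexive i+e≡j) (≤-trans (s≤s⁻¹ (toℕ<n j)) s≤N)))
  = begin
  iterate g x (N ! + N !)                ≡⟨ cong (λ k → iterate g x (N ! + k)) i+r≡N! ⟨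
  iterate g x (N ! + (toℕ i + r))        ≡⟨ cong (iterate g x) (sym (+-assoc (N !) (toℕ i) r)) ⟩
  iterate g x (N ! + toℕ i + r)          ≡⟨ cong (λ k → iterate g x (k + r)) (+-comm (N !) (toℕ i)) ⟩
  iterate g x (toℕ i + N ! + r)          ≡⟨ iterate-+ g x (toℕ i + N !) r ⟩
  iterate g (iterate g x (toℕ i + N !)) r
    ≡⟨ cong (λ y → iterate g y r) (iterate-+ g x (toℕ i) (N !)) ⟩
  iterate g (iterate g y (N !)) r        ≡⟨ cong (λ k → iterate g (iterate g y k) r) N!≡t*e ⟩
  iterate g (iterate g y (t * e)) r      ≡⟨ cong (λ z → iterate g z r) (iterate-loop g y e loop t) ⟩
  iterate g y r                          ≡⟨ iterate-+ g x (toℕ i) r ⟨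
  iterate g x (toℕ i + r)                ≡⟨ cong (iterate g x) i+r≡N! ⟩
  iterate g x (N !)                      ∎
  where
  open ≡-Reasoning
  y = iterate g x (toℕ i)
  loop : iterate g y e ≡ y
  loop = trans (sym (iterate-+ g x (toℕ i) e)) (trans (cong (iterate g x) i+e≡j) (sym eq))

-- Convolutions and the runs of an automaton on them

mapMaybe-proj₁-conv : {A : Set} (u v : List A) → mapMaybe proj₁ (conv u v) ≡ u
mapMaybe-proj₁-conv []      []      = refl
mapMaybe-proj₁-conv []      (_ ∷ v) = mapMaybe-proj₁-conv [] v
mapMaybe-proj₁-conv (x ∷ u) []      = cong (x ∷_) (mapMaybe-proj₁-conv u [])
mapMaybe-proj₁-conv (x ∷ u) (_ ∷ v) = cong (x ∷_) (mapMaybe-proj₁-conv u v)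

mapMaybe-proj₂-conv : {A : Set} (u v : List A) → mapMaybe proj₂ (conv u v) ≡ v
mapMaybe-proj₂-conv []      []      = refl
mapMaybe-proj₂-conv []      (y ∷ v) = cong (y ∷_) (mapMaybe-proj₂-conv [] v)
mapMaybe-proj₂-conv (_ ∷ u) []      = mapMaybe-proj₂-conv u []
mapMaybe-proj₂-conv (_ ∷ u) (y ∷ v) = cong (y ∷_) (mapMaybe-proj₂-conv u v)

-- Erasing the padding from either track recovers the word written there.
conv-injective : {A : Set} (u v u′ v′ : List A) → conv u v ≡ conv u′ v′ → u ≡ u′ × v ≡ v′
conv-injective u v u′ v′ eq =
  trans (sym (mapMaybe-proj₁-conv u v)) (trans (cong (mapMaybe proj₁) eq) (mapMaybe-proj₁-conv u′ v′)) ,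
  trans (sym (mapMaybe-proj₂-conv u v)) (trans (cong (mapMaybe proj₂) eq) (mapMaybe-proj₂-conv u′ v′))

a^ : ℕ → Word
a^ n = replicate n a

a^-length : ∀ u → a^ (length u) ≡ u
a^-length []      = refl
a^-length (a ∷ u) = cong (a ∷_) (a^-length u)

module _ {s : ℕ} (δ : Fin s → Maybe Letter × Maybe Letter → Fin s) where

  run : Fin s → ℕ → ℕ → Fin s
  run x m n = foldl δ x (conv (a^ m) (a^ n))

  δ-both δ-left δ-right : Fin s → Fin s
  δ-both  x = δ x (just a , just a)
  δ-left  x = δ x (just a , nothing)
  δ-right x = δ x (nothing , just a)

  run-both : ∀ x k m n → run x (k + m) (k + n) ≡ run (iterate δ-both x k) m n
  run-both x zero    m n = refl
  run-both x (suc k) m n = run-both (δ-both x) k m n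

  run-left : ∀ x m → run x m 0 ≡ iterate δ-left x m
  run-left x zero    = refl
  run-left x (suc m) = run-left (δ-left x) m

  run-right : ∀ x n → run x 0 n ≡ iterate δ-right x n
  run-right x zero    = refl
  run-right x (suc n) = run-right (δ-right x) n

  module _ {N : ℕ} (s≤N : s ≤ N) where

    iterate-period : (g : Fin s → Fin s) (x : Fin s) → ∀ r →
                     iterate g x (N ! + r) ≡ iterate g x (N ! + (N ! + r))
    iterate-period g x r = begin
      iterate g x (N ! + r)                   ≡⟨ iterate-+ g x (N !) r ⟩
      iterate g (iterate g x (N !)) r         ≡⟨ cong (λ y → iterate g y r) (iterate-idempotent s≤N g x) ⟨
      iterate g (iterate g x (N ! + N !)) r   ≡⟨ iterate-+ g x (N ! + N !) r ⟨
      iterate g x (N ! + N ! + r)             ≡⟨ cong (iterate g x) (+-assoc (N !) (N !) r) ⟩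
      iterate g x (N ! + (N ! + r))           ∎
      where open ≡-Reasoning

    run-diagonal : ∀ x {m n} → N ! ≤ m → N ! ≤ n → run x m n ≡ run x (N ! + m) (N ! + n)
    run-diagonal x p≤m p≤n
      with m′ , refl ← m≤n⇒∃[o]m+o≡n p≤m | n′ , refl ← m≤n⇒∃[o]m+o≡n p≤n = begin
      run x (N ! + m′) (N ! + n′)                                   ≡⟨ run-both x (N !) m′ n′ ⟩
      run (iterate δ-both x (N !)) m′ n′                            ≡⟨ cong (λ y → run y m′ n′) (iterate-idempotent s≤N δ-both x) ⟨
      run (iterate δ-both x (N ! + N !)) m′ n′                      ≡⟨ run-both x (N ! + N !) m′ n′ ⟨
      run x (N ! + N ! + m′) (N ! + N ! + n′)                       ≡⟨ cong₂ (run x) (+-assoc (N !) (N !) m′) (+-assoc (N !) (N !) n′) ⟩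
      run x (N ! + (N ! + m′)) (N ! + (N ! + n′))                   ∎
      where open ≡-Reasoning

    -- After the m paired letters the automaton iterates `δ-right` at least N! times, hence is
    -- already on a cycle whose length divides N!.
    run-right-period : ∀ x {m n} → N ! + m ≤ n → run x m n ≡ run x m (N ! + n)
    run-right-period x {m} p+m≤n with r , refl ← m≤n⇒∃[o]m+o≡n p+m≤n = begin
      run x m (N ! + m + r)                    ≡⟨ cong₂ (run x) (sym (+-identityʳ m)) shuffle ⟩
      run x (m + 0) (m + (N ! + r))            ≡⟨ run-both x m 0 (N ! + r) ⟩
      run y 0 (N ! + r)                        ≡⟨ run-right y (N ! + r) ⟩
      iterate δ-right y (N ! + r)              ≡⟨ iterate-period δ-right y r ⟩
      iterate δ-right y (N ! + (N ! + r))      ≡⟨ run-right y (N ! + (N ! + r)) ⟨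
      run y 0 (N ! + (N ! + r))                ≡⟨ run-both x m 0 (N ! + (N ! + r)) ⟨
      run x (m + 0) (m + (N ! + (N ! + r)))    ≡⟨ cong₂ (run x) (+-identityʳ m) shuffle′ ⟩
      run x m (N ! + (N ! + m + r))            ∎
      where
      open ≡-Reasoning
      y = iterate δ-both x m
      shuffle : N ! + m + r ≡ m + (N ! + r)
      shuffle = trans (cong (_+ r) (+-comm (N !) m)) (+-assoc m (N !) r)
      shuffle′ : m + (N ! + (N ! + r)) ≡ N ! + (N ! + m + r)
      shuffle′ = trans (trans (sym (+-assoc m (N !) (N ! + r))) (cong (_+ (N ! + r)) (+-comm m (N !))))
                   (trans (+-assoc (N !) m (N ! + r)) (cong (N ! +_) (sym shuffle)))

    run-left-period : ∀ x {m n} → N ! + n ≤ m → run x m n ≡ run x (N ! + m) n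
    run-left-period x {n = n} p+n≤m with r , refl ← m≤n⇒∃[o]m+o≡n p+n≤m = begin
      run x (N ! + n + r) n                    ≡⟨ cong₂ (run x) shuffle (sym (+-identityʳ n)) ⟩
      run x (n + (N ! + r)) (n + 0)            ≡⟨ run-both x n (N ! + r) 0 ⟩
      run y (N ! + r) 0                        ≡⟨ run-left y (N ! + r) ⟩
      iterate δ-left y (N ! + r)               ≡⟨ iterate-period δ-left y r ⟩
      iterate δ-left y (N ! + (N ! + r))       ≡⟨ run-left y (N ! + (N ! + r)) ⟨
      run y (N ! + (N ! + r)) 0                ≡⟨ run-both x n (N ! + (N ! + r)) 0 ⟨
      run x (n + (N ! + (N ! + r))) (n + 0)    ≡⟨ cong₂ (run x) shuffle′ (+-identityʳ n) ⟩
      run x (N ! + (N ! + n + r)) n            ∎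
      where
      open ≡-Reasoning
      y = iterate δ-both x n
      shuffle : N ! + n + r ≡ n + (N ! + r)
      shuffle = trans (cong (_+ r) (+-comm (N !) n)) (+-assoc n (N !) r)
      shuffle′ : n + (N ! + (N ! + r)) ≡ N ! + (N ! + n + r)
      shuffle′ = trans (trans (sym (+-assoc n (N !) (N ! + r))) (cong (_+ (N ! + r)) (+-comm n (N !))))
                   (trans (+-assoc (N !) n (N ! + r)) (cong (N ! +_) (sym shuffle)))

regular⇒periodic : {R : Rel Word 0ℓ} ((M , _) : RegularRelation R) →
                   ∀ {N} → DFA.states M ≤ N → Periodic (N !) (λ m n → R (a^ m) (a^ n))
regular⇒periodic {R} (M , recognises) s≤N = Periodic-resp-⇔ accepted record
  { diagonal = λ i j → ≡⇒⇔ (cong (_∈final) (run-diagonal step s≤N start i j))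
  ; right    = λ i → ≡⇒⇔ (cong (_∈final) (run-right-period step s≤N start i))
  ; left     = λ i → ≡⇒⇔ (cong (_∈final) (run-left-period step s≤N start i))
  }
  where
  open DFA M
  _∈final : Fin states → Set
  x ∈final = x Subset.∈ final
  accepted : ∀ m n → R (a^ m) (a^ n) ⇔ (run step start m n ∈final)
  accepted m n = mk⇔ (λ r → to (recognises _) (a^ m , a^ n , r , refl)) back
    where
    back : run step start m n ∈final → R (a^ m) (a^ n)
    -- Acceptance yields some related pair with this convolution; injectivity of `conv` identifies
    -- it with the given pair.
    back acc with u , v , r , eq ← from (recognises _) acc
             with refl , refl ← conv-injective (a^ m) (a^ n) u v eq = r

-- Periodic relations are regular

module _ (em : ExcludedMiddle 0ℓ) where

  -- The easy half of the Myhill-Nerode argument: an infinite-state automaton is divided by a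
  -- congruence of finite index that respects its final states. Excluded middle chooses
  -- representatives and decides which classes are final.
  finiteIndex⇒regular :
    {S A : Set} {N : ℕ} (class : S → Fin N) (δ : S → A → S) (s₀ : S) (F : Pred S 0ℓ) →
    (∀ {x y} c → class x ≡ class y → class (δ x c) ≡ class (δ y c)) →
    (∀ {x y} → class x ≡ class y → F x → F y) →
    Regular (λ w → F (foldl δ s₀ w))
  finiteIndex⇒regular {S} {A} {N} class δ s₀ F δ-cong F-cong = M , λ w → mk⇔ (complete w) (sound w)
    where
    InF : Fin N → Set
    InF i = ∃[ x ] (class x ≡ i × F x)

    representative : Fin N → S
    representative i with em {∃[ x ] class x ≡ i}
    ... | yes (x , _) = x
    -- A default for indices that are no class of a state; by `foldl-class` no run ever meets one.
    ... | no _        = s₀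

    class-representative : ∀ x → class (representative (class x)) ≡ class x
    class-representative x with em {∃[ y ] class y ≡ class x}
    ... | yes (_ , eq) = eq
    ... | no ¬y        = contradiction (x , refl) ¬y

    M : DFA A
    M = record
      { states = N
      ; start  = class s₀
      ; step   = λ i c → class (δ (representative i) c)
      ; final  = Vec.tabulate (λ i → does (em {InF i}))
      }
    open DFA M using (Accepts; step; final)

    foldl-class : ∀ x w → foldl step (class x) w ≡ class (foldl δ x w)
    foldl-class x []      = refl
    foldl-class x (c ∷ w) =
      trans (cong (λ i → foldl step i w) (δ-cong c (class-representative x))) (foldl-class (δ x c) w)

    does-true : ∀ {P : Set} (P? : Dec P) → P → does P? ≡ true
    does-true (yes _) _ = refl
    does-true (no ¬p) p = contradiction p ¬p

    true-does : ∀ {P : Set} (P? : Dec P) → does P? ≡ true → P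
    true-does (yes p) _ = p

    complete : ∀ w → F (foldl δ s₀ w) → Accepts w
    complete w Fx = lookup⇒[]= (foldl step (class s₀) w) final
      (trans (lookup∘tabulate _ (foldl step (class s₀) w))
        (does-true em (foldl δ s₀ w , sym (foldl-class s₀ w) , Fx)))

    sound : ∀ w → Accepts w → F (foldl δ s₀ w)
    sound w acc
      with x , eq , Fx ← true-does (em {InF _})
                           (trans (sym (lookup∘tabulate _ (foldl step (class s₀) w))) ([]=⇒lookup acc))
      = F-cong (trans eq (foldl-class s₀ w)) Fx

  -- An automaton with two counters, reduced to residues

  module _ {p : ℕ} (1≤p : 1 ≤ p) where

    p<p+p : p < p + p
    p<p+p = m<m+n p 1≤p

    next-residue : Fin (p + p) → Fin (p + p)
    next-residue i with suc (toℕ i) <? p + p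
    ... | yes 1+i<p+p = fromℕ< 1+i<p+p
    -- The successor of p + p - 1 is p rather than 0: periodicity sets in only at p, so smaller
    -- lengths must stay distinguishable.
    ... | no _        = fromℕ< p<p+p

    -- The residue of n in the monoid ⟨ 1 ∣ p = p + p ⟩.
    residue : ℕ → Fin (p + p)
    residue zero    = fromℕ< (<-≤-trans 1≤p (m≤m+n p p))
    residue (suc n) = next-residue (residue n)

    -- Each wrap removes p from the value and leaves it at p or more, where it then remains. So n is
    -- recovered from its residue by translations that start at arguments no smaller than p, where
    -- periodicity applies.
    residue-spec : ∀ n → ∃[ j ] (n ≡ j * p + toℕ (residue n) × (j ≡ 0 ⊎ p ≤ toℕ (residue n)))
    residue-spec zero = 0 , sym (toℕ-fromℕ< _) , inj₁ refl
    residue-spec (suc n) with residue-spec n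
    ... | j , n≡ , j-ok with suc (toℕ (residue n)) <? p + p
    ... | yes lt = j , trans (cong suc n≡) (trans (sym (+-suc (j * p) _)) (cong (j * p +_) (sym (toℕ-fromℕ< lt)))) , ok j-ok
      where
      ok : j ≡ 0 ⊎ p ≤ toℕ (residue n) → j ≡ 0 ⊎ p ≤ toℕ (fromℕ< lt)
      ok (inj₁ j≡0) = inj₁ j≡0
      ok (inj₂ p≤)  = inj₂ (subst (p ≤_) (sym (toℕ-fromℕ< lt)) (m≤n⇒m≤1+n p≤))
    ... | no ≮ = suc j , eq , inj₂ (≤-reflexive (sym (toℕ-fromℕ< p<p+p)))
      where
      open ≡-Reasoning
      eq : suc n ≡ p + j * p + toℕ (fromℕ< p<p+p)
      eq = begin
        suc n                                 ≡⟨ cong suc n≡ ⟩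
        suc (j * p + toℕ (residue n))         ≡⟨ +-suc (j * p) _ ⟨
        j * p + suc (toℕ (residue n))         ≡⟨ cong (j * p +_) (≤-antisym (toℕ<n (residue n)) (≮⇒≥ ≮)) ⟩
        j * p + (p + p)                       ≡⟨ +-assoc (j * p) p p ⟨
        j * p + p + p                         ≡⟨ cong₂ _+_ (+-comm (j * p) p) (sym (toℕ-fromℕ< p<p+p)) ⟩
        p + j * p + toℕ (fromℕ< p<p+p)        ∎

    residue-invariant : (P : Pred ℕ 0ℓ) → (∀ n → p ≤ n → P n ⇔ P (p + n)) →
                        ∀ {m n} → residue m ≡ residue n → P m ⇔ P n
    residue-invariant P shift {m} {n} eq =
      ⇔-trans (reduce m) (⇔-trans (≡⇒⇔ (cong (P ∘ toℕ) eq)) (⇔-sym (reduce n)))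
      where
      shifts : ∀ j i → p ≤ i → P (j * p + i) ⇔ P i
      shifts zero    i p≤i = ⇔-refl
      shifts (suc j) i p≤i =
        ⇔-trans (≡⇒⇔ (cong P (+-assoc p (j * p) i)))
          (⇔-trans (⇔-sym (shift (j * p + i) (m≤n⇒m≤o+n (j * p) p≤i))) (shifts j i p≤i))
      reduce : ∀ k → P k ⇔ P (toℕ (residue k))
      reduce k with residue-spec k
      ... | _ , k≡ , inj₁ refl = ≡⇒⇔ (cong P k≡)
      ... | j , k≡ , inj₂ p≤   = ⇔-trans (≡⇒⇔ (cong P k≡)) (shifts j _ p≤)

    -- A state (mode , m , d) records that conv u v has been read, where m is the
    -- smaller and m + d the larger of the two lengths.  The modes are: equal
    -- lengths, u longer, v longer, not a convolution.
    State : Set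
    State = Fin 4 × ℕ × ℕ

    read : State → Maybe Letter × Maybe Letter → State
    read (0F , m , d) (just _  , just _)  = 0F , suc m , d
    read (0F , m , d) (just _  , nothing) = 1F , m , suc d
    read (0F , m , d) (nothing , just _)  = 2F , m , suc d
    read (1F , m , d) (just _  , nothing) = 1F , m , suc d
    read (2F , m , d) (nothing , just _)  = 2F , m , suc d
    read _            _                   = 3F , 0 , 0

    encode : Fin 4 → Fin (p + p) → Fin (p + p) → Fin (4 * ((p + p) * (p + p)))
    encode t i j = combine t (combine i j)

    class : State → Fin (4 * ((p + p) * (p + p)))
    class (t , m , d) = encode t (residue m) (residue d)

    class-injective : ∀ {t m d t′ m′ d′} → class (t , m , d) ≡ class (t′ , m′ , d′) →
                      t ≡ t′ × residue m ≡ residue m′ × residue d ≡ residue d′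
    class-injective {t} {m} {d} {t′} {m′} {d′} eq
      with t≡ , eq′ ← combine-injective t _ t′ _ eq =
      t≡ , combine-injective (residue m) (residue d) (residue m′) (residue d′) eq′

    read-cong : ∀ {x y} c → class x ≡ class y → class (read x c) ≡ class (read y c)
    read-cong {t , m , d} {t′ , m′ , d′} c eq with class-injective {t} {m} {d} {t′} {m′} {d′} eq
    read-cong {0F , m , d} {_ , m′ , d′} (just _  , just _)  _ | refl , m≡ , d≡ = cong₂ (encode 0F) (cong next-residue m≡) d≡
    read-cong {0F , m , d} {_ , m′ , d′} (just _  , nothing) _ | refl , m≡ , d≡ = cong₂ (encode 1F) m≡ (cong next-residue d≡)
    read-cong {0F , m , d} {_ , m′ , d′} (nothing , just _)  _ | refl , m≡ , d≡ = cong₂ (encode 2F) m≡ (cong next-residue d≡)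
    read-cong {0F , m , d} {_ , m′ , d′} (nothing , nothing) _ | refl , m≡ , d≡ = refl
    read-cong {1F , m , d} {_ , m′ , d′} (just _  , just _)  _ | refl , m≡ , d≡ = refl
    read-cong {1F , m , d} {_ , m′ , d′} (just _  , nothing) _ | refl , m≡ , d≡ = cong₂ (encode 1F) m≡ (cong next-residue d≡)
    read-cong {1F , m , d} {_ , m′ , d′} (nothing , _)       _ | refl , m≡ , d≡ = refl
    read-cong {2F , m , d} {_ , m′ , d′} (just _  , _)       _ | refl , m≡ , d≡ = refl
    read-cong {2F , m , d} {_ , m′ , d′} (nothing , just _)  _ | refl , m≡ , d≡ = cong₂ (encode 2F) m≡ (cong next-residue d≡)
    read-cong {2F , m , d} {_ , m′ , d′} (nothing , nothing) _ | refl , m≡ , d≡ = refl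
    read-cong {3F , m , d} {_ , m′ , d′} _                   _ | refl , m≡ , d≡ = refl

    module _ {R : Rel ℕ 0ℓ} (per : Periodic p R) where
      open Periodic per

      Final : Pred State 0ℓ
      Final (0F , m , d) = R m m
      Final (1F , m , d) = R (m + d) m
      Final (2F , m , d) = R m (m + d)
      Final (3F , m , d) = ⊥

      -- The counters are exchanged one at a time. Changing m with d fixed is a diagonal
      -- translation; changing d with m fixed lengthens the longer word, and p ≤ d is exactly the
      -- gap that `left` and `right` require.
      Final-cong : ∀ {x y} → class x ≡ class y → Final x → Final y
      Final-cong {t , m , d} {t′ , m′ , d′} eq with class-injective {t} {m} {d} {t′} {m′} {d′} eq
      Final-cong {0F , m , d} {_ , m′ , d′} _ | refl , m≡ , d≡ =
        to (residue-invariant (λ k → R k k) (λ k p≤k → diagonal p≤k p≤k) m≡)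
      Final-cong {1F , m , d} {_ , m′ , d′} _ | refl , m≡ , d≡ =
        to (residue-invariant (λ k → R (m′ + k) m′) shift-d d≡) ∘
        to (residue-invariant (λ k → R (k + d) k) shift-m m≡)
        where
        shift-m : ∀ k → p ≤ k → R (k + d) k ⇔ R (p + k + d) (p + k)
        shift-m k p≤k = ⇔-trans (diagonal (m≤n⇒m≤n+o d p≤k) p≤k)
          (≡⇒⇔ (cong (λ l → R l (p + k)) (sym (+-assoc p k d))))
        shift-d : ∀ k → p ≤ k → R (m′ + k) m′ ⇔ R (m′ + (p + k)) m′
        shift-d k p≤k = ⇔-trans (left (subst (_≤ m′ + k) (+-comm m′ p) (+-monoʳ-≤ m′ p≤k)))
          (≡⇒⇔ (cong (λ l → R l m′) (x∙yz≈y∙xz +-commutativeSemigroup p m′ k)))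
      Final-cong {2F , m , d} {_ , m′ , d′} _ | refl , m≡ , d≡ =
        to (residue-invariant (λ k → R m′ (m′ + k)) shift-d d≡) ∘
        to (residue-invariant (λ k → R k (k + d)) shift-m m≡)
        where
        shift-m : ∀ k → p ≤ k → R k (k + d) ⇔ R (p + k) (p + k + d)
        shift-m k p≤k = ⇔-trans (diagonal p≤k (m≤n⇒m≤n+o d p≤k))
          (≡⇒⇔ (cong (R (p + k)) (sym (+-assoc p k d))))
        shift-d : ∀ k → p ≤ k → R m′ (m′ + k) ⇔ R m′ (m′ + (p + k))
        shift-d k p≤k = ⇔-trans (right (subst (_≤ m′ + k) (+-comm m′ p) (+-monoʳ-≤ m′ p≤k)))
          (≡⇒⇔ (cong (R m′) (x∙yz≈y∙xz +-commutativeSemigroup p m′ k)))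
      Final-cong {3F , m , d} {_ , m′ , d′} _ | refl , m≡ , d≡ = λ ()

      foldl-left : ∀ m d u → foldl read (1F , m , d) (conv u []) ≡ (1F , m , length u + d)
      foldl-left m d []      = refl
      foldl-left m d (_ ∷ u) = trans (foldl-left m (suc d) u) (cong (λ k → 1F , m , k) (+-suc (length u) d))

      foldl-right : ∀ m d v → foldl read (2F , m , d) (conv [] v) ≡ (2F , m , length v + d)
      foldl-right m d []      = refl
      foldl-right m d (_ ∷ v) = trans (foldl-right m (suc d) v) (cong (λ k → 2F , m , k) (+-suc (length v) d))

      Final-conv : ∀ k u v → Final (foldl read (0F , k , 0) (conv u v)) ≡ R (length u + k) (length v + k)
      Final-conv k []      []      = refl
      Final-conv k (_ ∷ u) []      = trans (cong Final (foldl-left k 1 u))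
        (cong (λ l → R l k) (trans (+-comm k (length u + 1)) (cong (_+ k) (+-comm (length u) 1))))
      Final-conv k []      (_ ∷ v) = trans (cong Final (foldl-right k 1 v))
        (cong (R k) (trans (+-comm k (length v + 1)) (cong (_+ k) (+-comm (length v) 1))))
      Final-conv k (_ ∷ u) (_ ∷ v) =
        trans (Final-conv (suc k) u v) (cong₂ R (+-suc (length u) k) (+-suc (length v) k))

      ¬Final-dead : ∀ m d w → Final (foldl read (3F , m , d) w) → ⊥
      ¬Final-dead m d (_ ∷ w) = ¬Final-dead 0 0 w

      parse-left : ∀ m d w → Final (foldl read (1F , m , d) w) → ∃[ u ] w ≡ conv u []
      parse-left m d []                       _   = [] , refl
      parse-left m d ((just x  , nothing) ∷ w) acc with u , refl ← parse-left m (suc d) w acc = x ∷ u , refl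
      parse-left m d ((just _  , just _)  ∷ w) acc = ⊥-elim (¬Final-dead 0 0 w acc)
      parse-left m d ((nothing , _)       ∷ w) acc = ⊥-elim (¬Final-dead 0 0 w acc)

      parse-right : ∀ m d w → Final (foldl read (2F , m , d) w) → ∃[ v ] w ≡ conv [] v
      parse-right m d []                       _   = [] , refl
      parse-right m d ((nothing , just y)  ∷ w) acc with v , refl ← parse-right m (suc d) w acc = y ∷ v , refl
      parse-right m d ((nothing , nothing) ∷ w) acc = ⊥-elim (¬Final-dead 0 0 w acc)
      parse-right m d ((just _  , _)       ∷ w) acc = ⊥-elim (¬Final-dead 0 0 w acc)

      -- The automaton must also reject words that are no convolutions. Once a track is padded, the
      -- mode admits only padding on that track, and every other letter leads to the dead mode.
      parse : ∀ m w → Final (foldl read (0F , m , 0) w) → ∃[ u ] ∃[ v ] w ≡ conv u v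
      parse m []                       _   = [] , [] , refl
      parse m ((just x  , just y)  ∷ w) acc with u , v , refl ← parse (suc m) w acc = x ∷ u , y ∷ v , refl
      parse m ((just x  , nothing) ∷ w) acc with u , refl ← parse-left m 1 w acc = x ∷ u , [] , refl
      parse m ((nothing , just y)  ∷ w) acc with v , refl ← parse-right m 1 w acc = [] , y ∷ v , refl
      parse m ((nothing , nothing) ∷ w) acc = ⊥-elim (¬Final-dead 0 0 w acc)

      periodic⇒regular : {S : Rel Word 0ℓ} → (∀ u v → S u v ⇔ R (length u) (length v)) → RegularRelation S
      periodic⇒regular {S} S⇔R
        with M , recognises ← finiteIndex⇒regular class read (0F , 0 , 0) Final
               (λ {x} {y} → read-cong {x} {y}) (λ {x} {y} → Final-cong {x} {y})
        = M , λ w → mk⇔ (to (recognises w) ∘ complete w) (sound w ∘ from (recognises w))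
        where
        Final⇔S : ∀ u v → Final (foldl read (0F , 0 , 0) (conv u v)) ⇔ S u v
        Final⇔S u v = ⇔-trans (≡⇒⇔ (trans (Final-conv 0 u v)
          (cong₂ R (+-identityʳ (length u)) (+-identityʳ (length v))))) (⇔-sym (S⇔R u v))
        complete : ∀ w → ∃[ u ] ∃[ v ] (S u v × w ≡ conv u v) → Final (foldl read (0F , 0 , 0) w)
        complete w (u , v , s , refl) = from (Final⇔S u v) s
        sound : ∀ w → Final (foldl read (0F , 0 , 0) w) → ∃[ u ] ∃[ v ] (S u v × w ≡ conv u v)
        sound w acc with u , v , refl ← parse 0 w acc = u , v , to (Final⇔S u v) acc , refl

-- Shapes of orbits

injection⇒≤size : {X : Set} {C : Pred X 0ℓ} {m n : ℕ} → HasSize C n →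
                  (g : Fin m → X) → Injective _≡_ _≡_ g → (∀ i → C (g i)) → m ≤ n
injection⇒≤size {C = C} (e , enum) g g-injective g∈C = injective⇒≤ {f = index} λ {i} {j} eq →
  g-injective (trans (sym (e-index i)) (trans (cong e eq) (e-index j)))
  where
  open Enumerates enum
  index : Fin _ → Fin _
  index i = proj₁ (to (image (g i)) (g∈C i))
  e-index : ∀ i → e (index i) ≡ g i
  e-index i = proj₂ (to (image (g i)) (g∈C i))

ℕ-injection⇒infinite : {X : Set} {C : Pred X 0ℓ} (g : ℕ → X) → Injective _≡_ _≡_ g →
                       (∀ i → C (g i)) → Infinite C
ℕ-injection⇒infinite g g-injective g∈C (n , size) =
  n≮n n (injection⇒≤size size (g ∘ toℕ) (toℕ-injective ∘ g-injective) (g∈C ∘ toℕ))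

module _ {X : Set} (_⟶_ : Rel X 0ℓ) (cancel : ∀ {x y z} → x ⟶ z → y ⟶ z → x ≡ y)
         (v : ℕ → X) (N : ℕ) (steps : ∀ {l} → l < N → v l ⟶ v (suc l)) where

  -- A coincidence on the path is pulled back edge by edge to its first vertex. The relation is
  -- abstract so that the argument serves edges, where cancelling is injectivity, and reversed
  -- edges, where it is functionality.
  rewind : ∀ i d → i + d ≤ N → v i ≡ v (i + d) → v 0 ≡ v d
  rewind zero    d _       eq = eq
  rewind (suc i) d i+d<N eq = rewind i d (<⇒≤ i+d<N)
    (cancel (subst (v i ⟶_) eq (steps (≤-<-trans (m≤m+n i d) i+d<N))) (steps i+d<N))

  module _ (noReturn : ∀ {d} → d < N → v 0 ≢ v (suc d)) where

    noReturn⇒distinct : ∀ {i j} → i < j → j ≤ N → v i ≢ v j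
    noReturn⇒distinct {i} i<j j≤N eq with d , refl ← m≤n⇒∃[o]m+o≡n i<j =
      noReturn (≤-trans (s≤s (m≤n+m d i)) j≤N)
        (rewind i (suc d) (subst (_≤ N) (sym (+-suc i d)) j≤N) (trans eq (cong v (sym (+-suc i d)))))

    noReturn⇒injective : ∀ {i j} → i ≤ N → j ≤ N → v i ≡ v j → i ≡ j
    noReturn⇒injective {i} {j} i≤N j≤N eq with <-cmp i j
    ... | tri< i<j _ _ = contradiction eq (noReturn⇒distinct i<j j≤N)
    ... | tri≈ _ i≡j _ = i≡j
    ... | tri> _ _ j<i = contradiction (sym eq) (noReturn⇒distinct j<i i≤N)

module _ (em : ExcludedMiddle 0ℓ) where

  by-contradiction : {P : Set} → ¬ ¬ P → P
  by-contradiction = decidable-stable em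

  least : {P : Pred ℕ 0ℓ} → ∃ P → ∃[ n ] (P n × (∀ m → P m → n ≤ m))
  least {P} (n , Pn) = <-rec (λ n → P n → ∃[ n ] (P n × (∀ m → P m → n ≤ m))) go n Pn
    where
    go : ∀ n → (∀ {m} → m < n → P m → _) → P n → _
    go n rec Pn with em {∃[ m ] (m < n × P m)}
    ... | yes (m , m<n , Pm) = rec m<n Pm
    ... | no none            = n , Pn , λ m Pm → ≮⇒≥ λ m<n → none (m , m<n , Pm)

-- Classification of the orbits of a partial injection

module _ {X : Set} (f : X → Maybe X) (f-injective : PartialInjective f) where

  private
    Orb = Orbit f

  HasSuccessor HasPredecessor : Pred X 0ℓ
  HasSuccessor x   = ∃[ y ] Edge f x y
  HasPredecessor y = ∃[ x ] Edge f x y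

  functional : ∀ {x y z} → Edge f x y → Edge f x z → y ≡ z
  functional e e′ = just-injective (trans (sym e) e′)

  -- Incoming and outgoing edges are unique, so `out` and `into` say that no edge joins the image to
  -- its complement. A walk from `v₀` therefore stays in the image, which makes the image the whole
  -- orbit.
  hasShape : ∀ {x} {V : Set} {_⟶_ : Rel V 0ℓ} (vertex : V → X) → Injective _≡_ _≡_ vertex →
             (v₀ : V) → (∀ v → Orb x (vertex v)) →
             (∀ {u v} → u ⟶ v → Edge f (vertex u) (vertex v)) →
             (∀ u → HasSuccessor (vertex u) → ∃[ v ] (u ⟶ v)) →
             (∀ u → HasPredecessor (vertex u) → ∃[ v ] (v ⟶ u)) →
             HasShape f (Orb x) V _⟶_
  hasShape {x} {V} {_⟶_} vertex vertex-injective v₀ inOrbit edge out into =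
    vertex , record { injective = vertex-injective ; image = λ y → mk⇔ (cover y) λ { (v , refl) → inOrbit v } } ,
    λ u v → mk⇔ (reflect u v) edge
    where
    walk : ∀ {y} u → Orb (vertex u) y → ∃[ v ] vertex v ≡ y
    walk u ε = u , refl
    walk u (fwd e ◅ r) with v , u⟶v ← out u (_ , e) with refl ← functional e (edge u⟶v) = walk v r
    walk u (bwd e ◅ r) with v , v⟶u ← into u (_ , e) with refl ← f-injective e (edge v⟶u) = walk v r

    cover : ∀ y → Orb x y → ∃[ v ] vertex v ≡ y
    cover y r = walk v₀ (symmetric _ (inOrbit v₀) ◅◅ r)

    reflect : ∀ u v → Edge f (vertex u) (vertex v) → u ⟶ v
    reflect u v e with v′ , u⟶v′ ← out u (_ , e) =
      subst (u ⟶_) (vertex-injective (functional (edge u⟶v′) e)) u⟶v′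

  -- Made total by a default, so that walks become iterates; that a step is an edge is derived only
  -- where a successor exists.
  next : X → X
  next x = fromMaybe x (f x)

  next-edge : ∀ {x} → HasSuccessor x → Edge f x (next x)
  next-edge {x} (y , e) rewrite e = refl

  module _ (em : ExcludedMiddle 0ℓ) where

    previous : X → X
    previous y with em {HasPredecessor y}
    ... | yes (x , _) = x
    ... | no _        = y

    previous-edge : ∀ {y} → HasPredecessor y → Edge f (previous y) y
    previous-edge {y} p with em {HasPredecessor y}
    ... | yes (_ , e) = e
    ... | no ¬p       = contradiction p ¬p

    module _ {x y : X} (x~y : Orb x y) where

      private
        v w : ℕ → X
        v = fold y next
        w = fold y previous

      forward-orbit : ∀ {N} → (∀ {l} → l < N → Edge f (v l) (v (suc l))) → ∀ {l} → l ≤ N → Orb x (v l)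
      forward-orbit steps {zero}  _   = x~y
      forward-orbit steps {suc l} l<N = forward-orbit steps (<⇒≤ l<N) ◅◅ fwd (steps l<N) ◅ ε

      -- A return to the source would give it a predecessor, so the walk from it has distinct
      -- vertices; the sink ends it.
      source-sink⇒finitePath : ¬ HasPredecessor y → ∀ n → (∀ {l} → l < n → Edge f (v l) (v (suc l))) →
                               ¬ HasSuccessor (v n) → IsFiniteDirectedPath f (Orb x)
      source-sink⇒finitePath source n steps sink = n , hasShape (v ∘ toℕ)
        (λ {i} {j} eq → toℕ-injective
          (noReturn⇒injective (Edge f) f-injective v n steps
            (λ {d} d<n eq → source (v d , subst (Edge f (v d)) (sym eq) (steps d<n)))
            (toℕ≤pred[n] i) (toℕ≤pred[n] j) eq))
        zero (λ i → forward-orbit steps (toℕ≤pred[n] i)) edge out into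
        where
        edge : ∀ {i j : Fin (suc n)} → toℕ j ≡ suc (toℕ i) → Edge f (v (toℕ i)) (v (toℕ j))
        edge {i} {j} eq = subst (Edge f (v (toℕ i)) ∘ v) (sym eq) (steps (subst (_≤ n) eq (toℕ≤pred[n] j)))
        out : ∀ i → HasSuccessor (v (toℕ i)) → ∃[ j ] (toℕ j ≡ suc (toℕ i))
        out i s with m≤n⇒m<n∨m≡n (toℕ≤pred[n] i)
        ... | inj₁ i<n = fromℕ< (s≤s i<n) , toℕ-fromℕ< (s≤s i<n)
        ... | inj₂ i≡n = contradiction (subst (HasSuccessor ∘ v) i≡n s) sink
        into : ∀ (i : Fin (suc n)) → HasPredecessor (v (toℕ i)) → ∃[ j ] (toℕ i ≡ suc (toℕ j))
        into zero    p = contradiction p source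
        into (suc i) p = inject₁ i , cong suc (sym (toℕ-inject₁ i))

      source⇒outward : ¬ HasPredecessor y → (∀ l → Edge f (v l) (v (suc l))) → IsOutwardInfinitePath f (Orb x)
      source⇒outward source steps = hasShape v
        (λ {i} {j} → noReturn⇒injective (Edge f) f-injective v (i ⊔ j) (λ {l} _ → steps l)
            (λ {d} _ eq → source (v d , subst (Edge f (v d)) (sym eq) (steps d)))
            (m≤m⊔n i j) (m≤n⊔m i j))
        0 (λ i → forward-orbit (λ {l} _ → steps l) (≤-refl {i})) (λ { {i} refl → steps i }) (λ i _ → suc i , refl) into
        where
        into : ∀ i → HasPredecessor (v i) → ∃[ j ] (i ≡ suc j)
        into zero    p = contradiction p source
        into (suc i) p = i , refl

      module _ (predecessors : ∀ {z} → Orb x z → HasPredecessor z) where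

        backward-orbit : ∀ l → Orb x (w l)
        backward-orbit zero    = x~y
        backward-orbit (suc l) = backward-orbit l ◅◅ bwd (previous-edge (predecessors (backward-orbit l))) ◅ ε

        backward-steps : ∀ l → Edge f (w (suc l)) (w l)
        backward-steps l = previous-edge (predecessors (backward-orbit l))

        sink⇒inward : ¬ HasSuccessor y → IsInwardInfinitePath f (Orb x)
        sink⇒inward sink = hasShape w
          (λ {i} {j} → noReturn⇒injective (flip (Edge f)) functional w (i ⊔ j) (λ {l} _ → backward-steps l)
            (λ {d} _ eq → sink (w d , subst (λ z → Edge f z (w d)) (sym eq) (backward-steps d)))
            (m≤m⊔n i j) (m≤n⊔m i j))
          0 backward-orbit (λ { {_} {j} refl → backward-steps j }) out (λ i _ → suc i , refl)
          where
          out : ∀ i → HasSuccessor (w i) → ∃[ j ] (i ≡ suc j)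
          out zero    s = contradiction s sink
          out (suc i) s = i , refl

    module _ {x : X} (predecessors : ∀ {z} → Orb x z → HasPredecessor z)
                     (successors : ∀ {z} → Orb x z → HasSuccessor z) where

      private
        v w : ℕ → X
        v = fold x next
        w = fold x previous

      v-orbit : ∀ l → Orb x (v l)
      v-orbit zero    = ε
      v-orbit (suc l) = v-orbit l ◅◅ fwd (next-edge (successors (v-orbit l))) ◅ ε

      steps : ∀ l → Edge f (v l) (v (suc l))
      steps l = next-edge (successors (v-orbit l))

      -- Minimality of n excludes earlier returns, so the vertices up to n are distinct, and the
      -- return itself is the closing edge from n to 0.
      firstReturn⇒cycle : ∀ n → v (suc n) ≡ x → (∀ m → v (suc m) ≡ x → n ≤ m) → IsDirectedCycle f (Orb x)
      firstReturn⇒cycle n return first = n , hasShape (v ∘ toℕ)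
        (λ {i} {j} eq → toℕ-injective
          (noReturn⇒injective (Edge f) f-injective v n (λ {l} _ → steps l)
            (λ d<n eq → <⇒≱ d<n (first _ (sym eq)))
            (toℕ≤pred[n] i) (toℕ≤pred[n] j) eq))
        zero (v-orbit ∘ toℕ) (λ {i} {j} eq → subst (Edge f (v (toℕ i)) ∘ v) (sym eq) (edge (toℕ≤pred[n] i)))
        (λ i _ → suc (toℕ i) mod suc n , toℕ-fromℕ< (m%n<n (suc (toℕ i)) (suc n)))
        (λ i _ → into i)
        where
        edge : ∀ {i} → i ≤ n → Edge f (v i) (v (suc i % suc n))
        edge {i} i≤n with m≤n⇒m<n∨m≡n i≤n
        ... | inj₁ i<n = subst (Edge f (v i) ∘ v) (sym (m<n⇒m%n≡m (s≤s i<n))) (steps i)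
        ... | inj₂ refl = subst (Edge f (v n)) (trans return (cong v (sym (n%n≡0 (suc n))))) (steps n)
        into : (i : Fin (suc n)) → ∃[ j ] (toℕ i ≡ suc (toℕ {suc n} j) % suc n)
        into zero    = fromℕ n , sym (trans (cong (λ k → suc k % suc n) (toℕ-fromℕ n)) (n%n≡0 (suc n)))
        into (suc i) = inject₁ i ,
          sym (trans (cong (λ k → suc k % suc n) (toℕ-inject₁ i)) (m<n⇒m%n≡m (s≤s (toℕ<n i))))

      -- The path is glued from the forward and the backward walk of x. If they met outside x,
      -- walking forward from the common vertex along the backward walk would bring the forward walk
      -- back to x.
      noReturn⇒biInfinite : (∀ n → v (suc n) ≢ x) → IsBiInfinitePath f (Orb x)
      noReturn⇒biInfinite noReturn = hasShape vertex (λ {i} {j} → vertex-injective i j) (pos 0) inOrbit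
        (λ { {i} refl → edge i }) (λ i _ → ℤ.suc i , refl) (λ i _ → ℤ.pred i , sym (ℤ.suc-pred i))
        where
        vertex : ℤ → X
        vertex (pos n)    = v n
        -- `w 0` is x, which already is the vertex 0, hence the shift by one.
        vertex -[1+ n ] = w (suc n)

        inOrbit : ∀ i → Orb x (vertex i)
        inOrbit (pos n)    = v-orbit n
        inOrbit -[1+ n ] = backward-orbit ε predecessors (suc n)

        edge : ∀ i → Edge f (vertex i) (vertex (ℤ.suc i))
        edge (pos n)          = steps n
        edge -[1+ zero ]    = backward-steps ε predecessors 0
        edge -[1+ suc n ]   = backward-steps ε predecessors (suc n)

        next-w : ∀ n → next (w (suc n)) ≡ w n
        next-w n = cong (fromMaybe (w (suc n))) (backward-steps ε predecessors n)

        forth-back : ∀ n k → fold (w n) next (k + n) ≡ v k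
        forth-back zero    k = cong v (+-identityʳ k)
        forth-back (suc n) k = begin
          fold (w (suc n)) next (k + suc n)       ≡⟨ cong (fold (w (suc n)) next) (trans (+-suc k n) (+-comm 1 (k + n))) ⟩
          fold (w (suc n)) next (k + n + 1)       ≡⟨ fold-+ (w (suc n)) next (k + n) ⟩
          fold (next (w (suc n))) next (k + n)    ≡⟨ cong (λ z → fold z next (k + n)) (next-w n) ⟩
          fold (w n) next (k + n)                          ≡⟨ forth-back n k ⟩
          v k                                              ∎
          where open ≡-Reasoning

        mixed : ∀ m n → v m ≢ w (suc n)
        mixed m n eq = noReturn (n + m) (begin
          v (suc n + m)                        ≡⟨ fold-+ x next (suc n) ⟩
          fold (v m) next (suc n)              ≡⟨ cong (λ z → fold z next (suc n)) eq ⟩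
          fold (w (suc n)) next (suc n)        ≡⟨ forth-back (suc n) 0 ⟩
          x                                    ∎)
          where open ≡-Reasoning

        w-noReturn : ∀ d → x ≢ w (suc d)
        w-noReturn d = mixed 0 d

        vertex-injective : ∀ i j → vertex i ≡ vertex j → i ≡ j
        vertex-injective (pos m) (pos n) eq = cong pos
          (noReturn⇒injective (Edge f) f-injective v (m ⊔ n) (λ {l} _ → steps l)
            (λ {d} _ → noReturn d ∘ sym) (m≤m⊔n m n) (m≤n⊔m m n) eq)
        vertex-injective (pos m)    -[1+ n ] eq = contradiction eq (mixed m n)
        vertex-injective -[1+ m ] (pos n)    eq = contradiction (sym eq) (mixed n m)
        vertex-injective -[1+ m ] -[1+ n ] eq = cong (-[1+_] ∘ pred)
          (noReturn⇒injective (flip (Edge f)) functional w (suc m ⊔ suc n)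
            (λ {l} _ → backward-steps ε predecessors l)
            (λ {d} _ → w-noReturn d) (m≤m⊔n (suc m) (suc n)) (m≤n⊔m (suc m) (suc n)) eq)

    private
      ¬∃⇒∀ : ∀ {x} {P : Pred X 0ℓ} → ¬ (∃[ y ] (Orb x y × ¬ P y)) → ∀ {y} → Orb x y → P y
      ¬∃⇒∀ none {y} r = by-contradiction em λ ¬Py → none (y , r , ¬Py)

    -- A source is sought first, then a sink, then a return to x; what is found serves as the
    -- starting vertex of the walk that exhausts the orbit.
    classify : ∀ x → (IsDirectedCycle f (Orb x) ⊎ IsFiniteDirectedPath f (Orb x)) ⊎
                     (IsOutwardInfinitePath f (Orb x) ⊎ IsInwardInfinitePath f (Orb x) ⊎ IsBiInfinitePath f (Orb x))
    classify x with em {∃[ y ] (Orb x y × ¬ HasPredecessor y)}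
    classify x | yes (y , x~y , source) with em {∃[ n ] ¬ HasSuccessor (fold y next n)}
    -- Only before the first sink are all steps of `next` genuine edges, so the least index is
    -- taken.
    ... | yes ends with n , sink , first ← least em ends =
      inj₁ (inj₂ (source-sink⇒finitePath x~y source n
        (λ {l} l<n → next-edge (by-contradiction em λ stuck → <⇒≱ l<n (first l stuck))) sink))
    ... | no endless = inj₂ (inj₁ (source⇒outward x~y source
        λ l → next-edge (by-contradiction em λ stuck → endless (l , stuck))))
    classify x | no noSource with em {∃[ y ] (Orb x y × ¬ HasSuccessor y)}
    ... | yes (y , x~y , sink) = inj₂ (inj₂ (inj₁ (sink⇒inward x~y (¬∃⇒∀ noSource) sink)))
    ... | no noSink with em {∃[ n ] (fold x next (suc n) ≡ x)}
    ...   | yes returns with n , return , first ← least em returns =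
      inj₁ (inj₁ (firstReturn⇒cycle (¬∃⇒∀ noSource) (¬∃⇒∀ noSink) n return first))
    ...   | no never = inj₂ (inj₂ (inj₂ (noReturn⇒biInfinite (¬∃⇒∀ noSource) (¬∃⇒∀ noSink) λ n eq → never (n , eq))))

    finite⇒cycle⊎path : ∀ x → Finite (Orb x) → IsDirectedCycle f (Orb x) ⊎ IsFiniteDirectedPath f (Orb x)
    finite⇒cycle⊎path x fin with classify x
    ... | inj₁ shape = shape
    ... | inj₂ (inj₁ (v , enum , _)) = contradiction fin
      (ℕ-injection⇒infinite v (Enumerates.injective enum) (λ i → from (Enumerates.image enum (v i)) (i , refl)))
    ... | inj₂ (inj₂ (inj₁ (v , enum , _))) = contradiction fin
      (ℕ-injection⇒infinite v (Enumerates.injective enum) (λ i → from (Enumerates.image enum (v i)) (i , refl)))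
    ... | inj₂ (inj₂ (inj₂ (v , enum , _))) = contradiction fin
      (ℕ-injection⇒infinite (v ∘ pos) (ℤ.+-injective ∘ Enumerates.injective enum)
        (λ i → from (Enumerates.image enum (v (pos i))) (pos i , refl)))

    infinite⇒path : ∀ x → Infinite (Orb x) →
      IsOutwardInfinitePath f (Orb x) ⊎ IsInwardInfinitePath f (Orb x) ⊎ IsBiInfinitePath f (Orb x)
    infinite⇒path x inf with classify x
    ... | inj₁ (inj₁ (n , v , enum , _)) = contradiction (suc n , v , enum) inf
    ... | inj₁ (inj₂ (n , v , enum , _)) = contradiction (suc n , v , enum) inf
    ... | inj₂ shape = shape

-- Orbits of presentable maps

module _ {p : ℕ} {R : Rel ℕ 0ℓ} (per : Periodic p R) where
  open Periodic per

  diagonal* : ∀ j {m n} → p ≤ m → p ≤ n → R m n ⇔ R (j * p + m) (j * p + n)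
  diagonal* zero    p≤m p≤n = ⇔-refl
  diagonal* (suc j) {m} {n} p≤m p≤n = ⇔-trans (diagonal* j p≤m p≤n)
    (⇔-trans (diagonal (m≤n⇒m≤o+n (j * p) p≤m) (m≤n⇒m≤o+n (j * p) p≤n))
      (≡⇒⇔ (cong₂ R (sym (+-assoc p (j * p) m)) (sym (+-assoc p (j * p) n)))))

  right* : ∀ j {m n} → p + m ≤ n → R m n ⇔ R m (j * p + n)
  right* zero    _     = ⇔-refl
  right* (suc j) {m} {n} p+m≤n = ⇔-trans (right* j p+m≤n)
    (⇔-trans (right (m≤n⇒m≤o+n (j * p) p+m≤n)) (≡⇒⇔ (cong (R m) (sym (+-assoc p (j * p) n)))))

%-≡⇒+-multiple : ∀ p .{{_ : NonZero p}} {m n} → m < n → m % p ≡ n % p → ∃[ c ] n ≡ suc c * p + m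
%-≡⇒+-multiple p {m} {n} m<n eq with m / p <? n / p
... | no m/p≮n/p = contradiction m<n (≤⇒≯ (begin
  n                     ≡⟨ m≡m%n+[m/n]*n n p ⟩
  n % p + n / p * p     ≤⟨ +-mono-≤ (≤-reflexive (sym eq)) (*-monoˡ-≤ p (≮⇒≥ m/p≮n/p)) ⟩
  m % p + m / p * p     ≡⟨ m≡m%n+[m/n]*n m p ⟨
  m                     ∎))
  where open ≤-Reasoning
... | yes m/p<n/p with c , c-spec ← m≤n⇒∃[o]m+o≡n m/p<n/p = c , (begin
  n                                 ≡⟨ m≡m%n+[m/n]*n n p ⟩
  n % p + n / p * p                 ≡⟨ cong₂ (λ r q → r + q * p) eq (trans (+-comm (suc c) (m / p)) (trans (+-suc (m / p) c) c-spec)) ⟨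
  m % p + (suc c + m / p) * p       ≡⟨ cong (m % p +_) (*-distribʳ-+ p (suc c) (m / p)) ⟩
  m % p + (suc c * p + m / p * p)   ≡⟨ x∙yz≈y∙xz +-commutativeSemigroup (m % p) (suc c * p) (m / p * p) ⟩
  suc c * p + (m % p + m / p * p)   ≡⟨ cong (suc c * p +_) (m≡m%n+[m/n]*n m p) ⟨
  suc c * p + m                     ∎)
  where
  open ≡-Reasoning

Finite-resp-⇔ : {X : Set} {C D : Pred X 0ℓ} → (∀ x → C x ⇔ D x) → Finite C → Finite D
Finite-resp-⇔ C⇔D (n , e , enum) = n , e , record
  { injective = Enumerates.injective enum
  ; image     = λ x → ⇔-trans (⇔-sym (C⇔D x)) (Enumerates.image enum x)
  }

EqClosure-chain : {A : Set} {R : Rel A 0ℓ} {n : ℕ} (u : Fin (suc n) → A) →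
                  (∀ {i j} → toℕ j ≡ suc (toℕ i) → R (u i) (u j)) → ∀ i j → EqClosure R (u i) (u j)
EqClosure-chain {A} {R} u step i j = symmetric _ (fromZero u step i) ◅◅ fromZero u step j
  where
  fromZero : ∀ {n} (u : Fin (suc n) → A) → (∀ {i j} → toℕ j ≡ suc (toℕ i) → R (u i) (u j)) →
             ∀ i → EqClosure R (u zero) (u i)
  fromZero         u step zero    = ε
  fromZero {suc n} u step (suc i) = fwd (step refl) ◅ fromZero (u ∘ suc) (step ∘ cong suc) i

upperBound : ∀ {n} (g : Fin n → ℕ) → ∃[ k ] (∀ i → g i ≤ k)
upperBound {zero}  g = 0 , λ ()
upperBound {suc n} g with k , g≤k ← upperBound (g ∘ suc) =
  g zero ⊔ k , λ { zero → m≤m⊔n (g zero) k ; (suc i) → ≤-trans (g≤k i) (m≤n⊔m (g zero) k) }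

module _ (em : ExcludedMiddle 0ℓ) where

  -- Induction on the bound: at most one point has the largest admissible code, and excluded middle
  -- decides whether there is one.
  boundedCode⇒finite : {X : Set} (code : X → ℕ) → Injective _≡_ _≡_ code →
                       ∀ k {C : Pred X 0ℓ} → (∀ {x} → C x → code x < k) → Finite C
  boundedCode⇒finite code code-injective zero bound =
    0 , (λ ()) , record { injective = λ { {()} } ; image = λ y → mk⇔ (λ Cy → contradiction (bound Cy) λ ()) λ () }
  boundedCode⇒finite {X} code code-injective (suc k) {C} bound
    with n , e , enum ← boundedCode⇒finite code code-injective k {λ x → C x × code x < k} proj₂
    with em {∃[ x ] (C x × code x ≡ k)}
  ... | no none = n , e , record { injective = injective ; image = λ y → ⇔-trans (below y) (image y) }
    where
    open Enumerates enum
    below : ∀ y → C y ⇔ (C y × code y < k)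
    below y = mk⇔ (λ Cy → Cy , ≤∧≢⇒< (s≤s⁻¹ (bound Cy)) λ eq → none (y , Cy , eq)) proj₁
  ... | yes (x , Cx , code-x) = suc n , x Vector.∷ e , record
    { injective = λ {i} {j} → injective′ i j ; image = λ y → mk⇔ (cover y) (λ { (i , refl) → inC i }) }
    where
    open Enumerates enum
    x∉e : ∀ i → x ≢ e i
    x∉e i refl = <-irrefl code-x (proj₂ (from (image x) (i , refl)))
    injective′ : ∀ i j → (x Vector.∷ e) i ≡ (x Vector.∷ e) j → i ≡ j
    injective′ zero    zero    _  = refl
    injective′ zero    (suc j) eq = contradiction eq (x∉e j)
    injective′ (suc i) zero    eq = contradiction (sym eq) (x∉e i)
    injective′ (suc i) (suc j) eq = cong suc (injective eq)
    inC : ∀ i → C ((x Vector.∷ e) i)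
    inC zero    = Cx
    inC (suc i) = proj₁ (from (image (e i)) (i , refl))
    cover : ∀ y → C y → ∃[ i ] (x Vector.∷ e) i ≡ y
    cover y Cy with m≤n⇒m<n∨m≡n (s≤s⁻¹ (bound Cy))
    ... | inj₂ code-y = zero , code-injective (trans code-x (sym code-y))
    ... | inj₁ code-y<k with i , eq ← to (image y) (Cy , code-y<k) = suc i , eq

  infinite⇒unbounded : {X : Set} (code : X → ℕ) → Injective _≡_ _≡_ code →
                       {C : Pred X 0ℓ} → Infinite C → ∀ k → ∃[ x ] (C x × k ≤ code x)
  infinite⇒unbounded code code-injective inf k = by-contradiction em λ none →
    inf (boundedCode⇒finite code code-injective k λ {x} Cx → ≰⇒> λ k≤ → none (x , Cx , k≤))

-- Bounds on orbits, where `Rep m x` means that the word of length m denotes x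

module _ (em : ExcludedMiddle 0ℓ) {X : Set} (f : X → Maybe X) (f-injective : PartialInjective f)
  (Rep : ℕ → Pred X 0ℓ)
  (Rep-functional : ∀ {m x y} → Rep m x → Rep m y → x ≡ y)
  (code : X → ℕ) (code-Rep : ∀ x → Rep (code x) x) (code-least : ∀ {m x} → Rep m x → code x ≤ m)
  {p : ℕ} (1≤p : 1 ≤ p)
  (≡-periodic : Periodic p (λ m n → ∃[ x ] (Rep m x × Rep n x)))
  (f-periodic : Periodic p (λ m n → ∃[ x ] ∃[ y ] (Rep m x × Rep n y × Edge f x y)))
  where

  private
    Orb = Orbit f
    Same Step : Rel ℕ 0ℓ
    Same m n = ∃[ x ] (Rep m x × Rep n x)
    Step m n = ∃[ x ] ∃[ y ] (Rep m x × Rep n y × Edge f x y)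

  code-injective : Injective _≡_ _≡_ code
  code-injective {x} {y} eq = Rep-functional (code-Rep x) (subst (λ m → Rep m y) (sym eq) (code-Rep y))

  width : ℕ
  width = p + p

  private
    ¬Rep-below : ∀ {m x} → code x ≡ p + m → ¬ Rep m x
    ¬Rep-below {m} eq r = <⇒≱ (m<n+m m 1≤p) (≤-trans (≤-reflexive (sym eq)) (code-least r))

    far⇒gap : ∀ {m n} → width + m ≤ n → ∃[ n′ ] (n ≡ p + n′ × p + m ≤ n′)
    far⇒gap {m} far with r , refl ← m≤n⇒∃[o]m+o≡n far =
      p + m + r , trans (cong (_+ r) (+-assoc p p m)) (+-assoc p (p + m) r) , m≤m+n (p + m) r

  -- A gap of 2p leaves a gap of p after removing p letters from the word of y, as `right` demands.
  -- The shortened word is still a target of x, so by functionality it denotes y, against the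
  -- minimality of `code y`.
  edge-targetNear : ∀ {x y} → Edge f x y → code y < width + code x
  edge-targetNear {x} {y} e = ≰⇒> λ far →
    let n , eq , gap = far⇒gap far
        x′ , y′ , rx , ry , e′ = from (Periodic.right f-periodic gap)
          (subst (Step (code x)) eq (x , y , code-Rep x , code-Rep y , e))
    in ¬Rep-below eq (subst (Rep n) (functional f f-injective e′ (subst (λ z → Edge f z y) (Rep-functional (code-Rep x) rx) e)) ry)

  edge-sourceNear : ∀ {x y} → Edge f x y → code x < width + code y
  edge-sourceNear {x} {y} e = ≰⇒> λ far →
    let n , eq , gap = far⇒gap far
        x′ , y′ , rx , ry , e′ = from (Periodic.left f-periodic gap)
          (subst (λ m → Step m (code y)) eq (x , y , code-Rep x , code-Rep y , e))
    in ¬Rep-below eq (subst (Rep n) (f-injective e′ (subst (Edge f x) (Rep-functional (code-Rep y) ry) e)) rx)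

  neighbour-near : ∀ {x y} → SymClosure (Edge f) x y → code y < width + code x
  neighbour-near (fwd e) = edge-targetNear e
  neighbour-near (bwd e) = edge-sourceNear e

  -- An orbit moves by less than width, so it cannot jump over a window of that width.
  window : ∀ {k x z} → Orb x z → k ≤ code z → code x < width + k →
           ∃[ y ] (Orb x y × k ≤ code y × code y < width + k)
  window {k} {x} r k≤z x< with k ≤? code x
  window {k} {x} r       k≤z x< | yes k≤x = x , ε , k≤x , x<
  window {k} {x} ε       k≤z x< | no k≰x  = contradiction k≤z k≰x
  window {k} {x} (s ◅ r) k≤z x< | no k≰x
    with y , o , k≤y , y< ← window r k≤z (<-trans (neighbour-near s) (+-monoʳ-< width (≰⇒> k≰x))) = y , s ◅ o , k≤y , y<

  Independent : ℕ → Set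
  Independent n = Σ[ xs ∈ (Fin n → X) ]
    ((∀ i → Infinite (Orb (xs i))) × (∀ {i j} → i Fin.< j → ¬ Orb (xs i) (xs j)))

  -- Every orbit here meets the window from k to k + 2p. Points of different orbits have different
  -- codes, and the window has room for 2p of them.
  independent⇒≤width : ∀ {n} → Independent n → n ≤ width
  independent⇒≤width {n} (xs , inf , indep) = ≮⇒≥ λ width<n →
    let i , j , i<j , eq = pigeonhole width<n slot in
    indep i<j (subst (Orb (xs i)) (code-injective (slot-injective eq)) (y∈orbit i) ◅◅ symmetric _ (y∈orbit j))
    where
    -- The window is placed so that no starting point lies above its lower end; being infinite, each
    -- orbit also reaches k or beyond.
    k = proj₁ (upperBound (code ∘ xs))

    meets : ∀ i → ∃[ y ] (Orb (xs i) y × k ≤ code y × code y < width + k)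
    meets i with z , r , k≤z ← infinite⇒unbounded em code code-injective (inf i) k =
      window r k≤z (≤-<-trans (proj₂ (upperBound (code ∘ xs)) i) (m<n+m k (≤-trans 1≤p (m≤m+n p p))))

    y : Fin n → X
    y = proj₁ ∘ meets
    y∈orbit : ∀ i → Orb (xs i) (y i)
    y∈orbit i = proj₁ (proj₂ (meets i))
    k≤y : ∀ i → k ≤ code (y i)
    k≤y i = proj₁ (proj₂ (proj₂ (meets i)))

    offset<width : ∀ i → code (y i) ∸ k < width
    offset<width i = +-cancelʳ-< k _ _ (subst (_< width + k) (sym (m∸n+n≡m (k≤y i))) (proj₂ (proj₂ (proj₂ (meets i)))))
    slot : Fin n → Fin width
    slot i = fromℕ< (offset<width i)
    slot-injective : ∀ {i j} → slot i ≡ slot j → code (y i) ≡ code (y j)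
    slot-injective {i} {j} eq = ∸-cancelʳ-≡ (k≤y i) (k≤y j) (fromℕ<-injective _ _ (offset<width i) (offset<width j) eq)

  -- An independent family is enlarged until it is maximal, and then it meets every infinite orbit.
  -- Exhausted fuel would mean 2p + 1 independent points.
  finitelyManyInfiniteOrbits : FinitelyManyInfiniteOrbits f
  finitelyManyInfiniteOrbits = extend (suc width) 0 (+-identityʳ (suc width)) ((λ ()) , (λ ()) , λ { {()} })
    where
    extend : ∀ fuel n → fuel + n ≡ suc width → Independent n → FinitelyManyInfiniteOrbits f
    extend zero       n refl ind = contradiction (independent⇒≤width ind) (n≮n width)
    extend (suc fuel) n eq ind@(xs , inf , indep) with em {∃[ x ] (Infinite (Orb x) × (∀ i → ¬ Orb x (xs i)))}
    ... | yes (x , x-inf , x-indep) = extend fuel (suc n) (trans (+-suc fuel n) eq)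
          (x Vector.∷ xs , (λ { zero → x-inf ; (suc i) → inf i }) ,
           λ { {zero} {suc j} _ → x-indep j ; {suc i} {suc j} i<j → indep (s≤s⁻¹ i<j) })
    ... | no maximal = tabulate xs , λ x x-inf →
          let i , r = by-contradiction em {∃[ i ] Orb x (xs i)} λ none →
                maximal (x , x-inf , λ i r → none (i , r))
          in tabulate⁺ i r

  private
    -- Both lengths are at least p, so whole chains of such steps, traversed in either direction,
    -- can be translated by multiples of p.
    HighStep : Rel ℕ 0ℓ
    HighStep m n = p ≤ m × p ≤ n × Step m n

  highStep-shift : ∀ j {m n} → EqClosure HighStep m n → EqClosure HighStep (j * p + m) (j * p + n)
  highStep-shift j = gmap (j * p +_) λ (p≤m , p≤n , s) →
    m≤n⇒m≤o+n (j * p) p≤m , m≤n⇒m≤o+n (j * p) p≤n , to (diagonal* f-periodic j p≤m p≤n) s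

  highStep-orbit : ∀ {m n x} → EqClosure HighStep m n → Rep m x → ∃[ y ] (Rep n y × Orb x y)
  highStep-orbit ε r = _ , r , ε
  highStep-orbit (fwd (_ , _ , x′ , y′ , rx , ry , e) ◅ s) r
    with refl ← Rep-functional r rx with y , r′ , o ← highStep-orbit s ry = y , r′ , fwd e ◅ o
  highStep-orbit (bwd (_ , _ , x′ , y′ , rx , ry , e) ◅ s) r
    with refl ← Rep-functional r ry with y , r′ , o ← highStep-orbit s rx = y , r′ , bwd e ◅ o

  -- Translating the connection repeatedly connects x to words of arbitrarily large
  -- length; two of them name the same point, and by periodicity so do m and m + e.
  connectedTranslate⇒same : ∀ {m x} c → let e = suc c * p in Finite (Orb x) → p ≤ m → Rep m x →
                            EqClosure HighStep m (e + m) → Same m (e + m)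
  connectedTranslate⇒same {m} {x} c fin p≤m rep connection = by-contradiction em λ different →
    ℕ-injection⇒infinite y (λ {i} {j} → y-injective different i j) (λ k → proj₂ (proj₂ (reached k))) fin
    where
    e = suc c * p
    p≤e+m : p ≤ e + m
    p≤e+m = m≤n⇒m≤o+n e p≤m

    chain : ∀ k → EqClosure HighStep m (k * e + m)
    chain zero    = ε
    chain (suc k) = connection ◅◅
      subst (EqClosure HighStep (e + m)) (sym (+-assoc e (k * e) m)) (highStep-shift (suc c) (chain k))

    reached : ∀ k → ∃[ y ] (Rep (k * e + m) y × Orb x y)
    reached k = highStep-orbit (chain k) rep
    y : ℕ → X
    y k = proj₁ (reached k)
    y-Rep : ∀ k → Rep (k * e + m) (y k)
    y-Rep k = proj₁ (proj₂ (reached k))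

    -- The common point has words of lengths ie + m and (i + 1 + d)e + m. Removing ie from both
    -- diagonally, and then de from the longer one, leaves m and e + m.
    collapse : ∀ i d → y i ≡ y (suc i + d) → Same m (e + m)
    collapse i d eq = from (right* ≡-periodic (d * suc c) p+m≤e+m)
      (subst (Same m) (cong (_+ (e + m)) (sym (*-assoc d (suc c) p)))
        (from (diagonal* ≡-periodic (i * suc c) p≤m (m≤n⇒m≤o+n (d * e) p≤e+m))
          (subst₂ Same (cong (_+ m) (sym (*-assoc i (suc c) p))) length≡
            (y i , y-Rep i , subst (Rep _) (sym eq) (y-Rep (suc i + d))))))
      where
      p+m≤e+m : p + m ≤ e + m
      p+m≤e+m = +-monoˡ-≤ m (m≤m+n p (c * p))
      open ≡-Reasoning
      length≡ : (suc i + d) * e + m ≡ i * suc c * p + (d * e + (e + m))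
      length≡ = begin
        e + (i + d) * e + m                    ≡⟨ cong (λ k → e + k + m) (*-distribʳ-+ e i d) ⟩
        e + (i * e + d * e) + m                ≡⟨ cong (_+ m) (+-comm e (i * e + d * e)) ⟩
        i * e + d * e + e + m                  ≡⟨ +-assoc (i * e + d * e) e m ⟩
        i * e + d * e + (e + m)                ≡⟨ +-assoc (i * e) (d * e) (e + m) ⟩
        i * e + (d * e + (e + m))              ≡⟨ cong (_+ (d * e + (e + m))) (*-assoc i (suc c) p) ⟨
        i * suc c * p + (d * e + (e + m))      ∎

    y-injective : ¬ Same m (e + m) → ∀ i j → y i ≡ y j → i ≡ j
    y-injective different i j eq with <-cmp i j
    ... | tri≈ _ i≡j _ = i≡j
    ... | tri< i<j _ _ with d , refl ← m≤n⇒∃[o]m+o≡n i<j = contradiction (collapse i d eq) different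
    ... | tri> _ _ j<i with d , refl ← m≤n⇒∃[o]m+o≡n j<i = contradiction (collapse j d (sym eq)) different

  -- Otherwise the shortest words of x and y, whose lengths differ by a positive multiple of p,
  -- would denote one point, although `code x < code y`.
  congruent⇒¬connected : ∀ {x y} → let instance _ = >-nonZero 1≤p in
                         Finite (Orb x) → p ≤ code x → code x < code y → code x % p ≡ code y % p →
                         ¬ EqClosure HighStep (code x) (code y)
  congruent⇒¬connected {x} {y} fin p≤x x<y x≡y connection
    with c , eq ← %-≡⇒+-multiple p {{>-nonZero 1≤p}} x<y x≡y
    with z , rx , ry ← connectedTranslate⇒same c fin p≤x (code-Rep x) (subst (EqClosure HighStep (code x)) eq connection)
    = <-irrefl (cong code (trans (Rep-functional (code-Rep x) rx)
        (Rep-functional ry (subst (λ m → Rep m y) eq (code-Rep y))))) x<y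

  module _ {x : X} (fin : Finite (Orb x)) where

    -- Two of the p + 1 codes are congruent mod p. Codes need not increase along the path, so either
    -- of the two points may have to play the part of the shorter one.
    ¬highPath : (u : Fin (suc p) → X) → Injective _≡_ _≡_ u → (∀ i → Orb x (u i)) →
                (∀ {i j} → toℕ j ≡ suc (toℕ i) → Edge f (u i) (u j)) → ¬ (∀ i → p ≤ code (u i))
    ¬highPath u u-injective u∈orbit edge high = conflict (pigeonhole (n<1+n p) (λ i → code (u i) mod p))
      where
      instance _ = >-nonZero 1≤p
      connected : ∀ i j → EqClosure HighStep (code (u i)) (code (u j))
      connected = EqClosure-chain (code ∘ u) λ {i} {j} eq →
        high i , high j , u i , u j , code-Rep (u i) , code-Rep (u j) , edge eq
      finite-at : ∀ i → Finite (Orb (u i))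
      finite-at i = Finite-resp-⇔ (λ z → mk⇔ (symmetric _ (u∈orbit i) ◅◅_) (u∈orbit i ◅◅_)) fin
      conflict : ¬ (∃[ i ] ∃[ j ] (i Fin.< j × code (u i) mod p ≡ code (u j) mod p))
      conflict (i , j , i<j , eq) with <-cmp (code (u i)) (code (u j))
        | fromℕ<-injective _ _ (m%n<n (code (u i)) p) (m%n<n (code (u j)) p) eq
      ... | tri< lt _ _ | eq′ = congruent⇒¬connected (finite-at i) (high i) lt eq′ (connected i j)
      ... | tri≈ _ same _ | _ = Fin.<⇒≢ i<j (u-injective (code-injective same))
      ... | tri> _ _ gt | eq′ = congruent⇒¬connected (finite-at j) (high j) gt (sym eq′) (connected j i)

    -- The path is cut into p + 1 blocks of p + 1 consecutive vertices, `combine i j` being position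
    -- j of block i. Each block has a vertex of code below p, so two blocks would share one.
    path-bounded : ∀ {n} (v : Fin n → X) → Injective _≡_ _≡_ v → (∀ i → Orb x (v i)) →
                   (∀ {i j} → toℕ j ≡ suc (toℕ i) → Edge f (v i) (v j)) → n ≤ suc p * suc p
    path-bounded {n} v v-injective v∈orbit edge = ≮⇒≥ λ long → conflict (<⇒≤ long)
      where
      module _ (N≤n : suc p * suc p ≤ n) where
        u : Fin (suc p) → Fin (suc p) → X
        u i j = v (inject≤ (combine i j) N≤n)
        u-injective : ∀ {i j k l} → u i j ≡ u k l → i ≡ k × j ≡ l
        u-injective {i} {j} {k} {l} eq = combine-injective i j k l (inject≤-injective N≤n N≤n _ _ (v-injective eq))
        u-edge : ∀ i {j k} → toℕ k ≡ suc (toℕ j) → Edge f (u i j) (u i k)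
        u-edge i {j} {k} eq = edge (begin
          toℕ (inject≤ (combine i k) N≤n)         ≡⟨ trans (toℕ-inject≤ _ N≤n) (toℕ-combine i k) ⟩
          suc p * toℕ i + toℕ k                   ≡⟨ trans (cong (suc p * toℕ i +_) eq) (+-suc (suc p * toℕ i) (toℕ j)) ⟩
          suc (suc p * toℕ i + toℕ j)             ≡⟨ cong suc (trans (toℕ-inject≤ _ N≤n) (toℕ-combine i j)) ⟨
          suc (toℕ (inject≤ (combine i j) N≤n))   ∎)
          where open ≡-Reasoning
        low : ∀ i → ∃[ j ] code (u i j) < p
        low i = by-contradiction em λ none →
          ¬highPath (u i) (λ {j} {k} → proj₂ ∘ u-injective {i} {j} {i} {k}) (λ j → v∈orbit _) (u-edge i) (λ j → ≮⇒≥ λ lt → none (j , lt))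
        conflict : ⊥
        conflict with i , k , i<k , eq ← pigeonhole (n<1+n p) (λ i → fromℕ< (proj₂ (low i))) =
          Fin.<⇒≢ i<k (proj₁ (u-injective (code-injective (fromℕ<-injective _ _ (proj₂ (low i)) (proj₂ (low k)) eq))))

  finiteOrbitsBounded : FiniteOrbitsBounded f
  finiteOrbitsBounded = suc p * suc p , bound
    where
    bound : ∀ x n → HasSize (Orb x) n → n ≤ suc p * suc p
    bound x n size@(e , e-enum) with finite⇒cycle⊎path f f-injective em x (n , size)
    -- Without its closing edge a cycle is a path through all its vertices.
    ... | inj₁ (k , v , v-enum , edges) = ≤-trans
      (injection⇒≤size (v , v-enum) e (Enumerates.injective e-enum) (λ i → from (Enumerates.image e-enum (e i)) (i , refl)))
      (path-bounded (n , size) v (Enumerates.injective v-enum) (λ i → from (Enumerates.image v-enum (v i)) (i , refl))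
        λ {i} {j} eq → from (edges i j) (trans eq (sym (m<n⇒m%n≡m (subst (_< suc k) eq (toℕ<n j))))))
    ... | inj₂ (k , v , v-enum , edges) = ≤-trans
      (injection⇒≤size (v , v-enum) e (Enumerates.injective e-enum) (λ i → from (Enumerates.image e-enum (e i)) (i , refl)))
      (path-bounded (n , size) v (Enumerates.injective v-enum) (λ i → from (Enumerates.image v-enum (v i)) (i , refl))
        λ {i} {j} eq → from (edges i j) eq)

presentable⇒bounded×finitelyMany : ExcludedMiddle 0ℓ → {X : Set} (f : X → Maybe X) → PartialInjective f →
  UnaryFAPresentable f → FiniteOrbitsBounded f × FinitelyManyInfiniteOrbits f
presentable⇒bounded×finitelyMany em {X} f f-injective presentation =
  finiteOrbitsBounded em f f-injective Rep Rep-functional code code-Rep code-least (1≤n! N) ≡-periodic f-periodic ,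
  finitelyManyInfiniteOrbits em f f-injective Rep Rep-functional code code-Rep code-least (1≤n! N) ≡-periodic f-periodic
  where
  open UnaryFAPresentable presentation
  -- The sum bounds both numbers of states, so N! is a common period.
  N = DFA.states (proj₁ ≡-regular) + DFA.states (proj₁ f-regular)

  Rep : ℕ → Pred X 0ℓ
  Rep m x = Σ[ l ∈ L (a^ m) ] φ (a^ m) l ≡ x

  -- Two proofs of membership give the same point because `φ` takes them irrelevantly.
  Rep-functional : ∀ {m x y} → Rep m x → Rep m y → x ≡ y
  Rep-functional (_ , refl) (_ , refl) = refl

  Rep-surjective : ∀ x → ∃[ m ] Rep m x
  Rep-surjective x with u , l , eq ← φ-surjective x =
    length u , subst (λ w → Σ[ l ∈ L w ] φ w l ≡ x) (sym (a^-length u)) (l , eq)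

  leastCode : ∀ x → ∃[ m ] (Rep m x × (∀ n → Rep n x → m ≤ n))
  leastCode x = least em (Rep-surjective x)
  code : X → ℕ
  code x = proj₁ (leastCode x)
  code-Rep : ∀ x → Rep (code x) x
  code-Rep x = proj₁ (proj₂ (leastCode x))
  code-least : ∀ {m x} → Rep m x → code x ≤ m
  code-least {m} {x} = proj₂ (proj₂ (leastCode x)) m

  ≡-periodic : Periodic (N !) (λ m n → ∃[ x ] (Rep m x × Rep n x))
  ≡-periodic = Periodic-resp-⇔
    (λ m n → mk⇔ (λ { (_ , (l , eq) , (l′ , eq′)) → l , l′ , trans eq (sym eq′) })
                 (λ { (l , l′ , eq) → _ , (l , eq) , (l′ , refl) }))
    (regular⇒periodic ≡-regular {N} (m≤m+n _ _))

  f-periodic : Periodic (N !) (λ m n → ∃[ x ] ∃[ y ] (Rep m x × Rep n y × Edge f x y))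
  f-periodic = Periodic-resp-⇔
    (λ m n → mk⇔ (λ { (_ , _ , (l , refl) , (l′ , refl) , e) → l , l′ , e })
                 (λ { (l , l′ , e) → _ , _ , (l , refl) , (l′ , refl) , e }))
    (regular⇒periodic f-regular {N} (m≤n+m _ (DFA.states (proj₁ ≡-regular))))

-- Construction of presentations

constant-periodic : ∀ {p} {A : Set} → Periodic p (λ _ _ → A)
constant-periodic = record { diagonal = λ _ _ → ⇔-refl ; right = λ _ → ⇔-refl ; left = λ _ → ⇔-refl }

empty-periodic : ∀ {p R} → (∀ m n → ¬ R m n) → Periodic p R
empty-periodic none = Periodic-resp-⇔ (λ m n → mk⇔ (none m n) ⊥-elim) constant-periodic

-- The related lengths differ by at most 1, so beyond a gap of 2 both sides of `left` and `right`
-- are empty. A period of 1 would already fail for the successor relation.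
banded-periodic : ∀ {R} → (∀ m n → R (suc m) (suc n) ⇔ R (2 + m) (2 + n)) →
                  (∀ {m n} → R m n → n ≤ suc m × m ≤ suc n) → Periodic 2 R
banded-periodic {R} shift band = record
  { diagonal = λ { (s≤s (s≤s (z≤n {m}))) (s≤s (s≤s (z≤n {n}))) → ⇔-trans (shift _ _) (shift _ _) }
  ; right    = λ far → mk⇔ (λ r → contradiction (proj₁ (band r)) (<⇒≱ far))
                           (λ r → contradiction (proj₁ (band r)) (<⇒≱ (m≤n⇒m≤o+n 2 far)))
  ; left     = λ far → mk⇔ (λ r → contradiction (proj₂ (band r)) (<⇒≱ far))
                           (λ r → contradiction (proj₂ (band r)) (<⇒≱ (m≤n⇒m≤o+n 2 far)))
  }

-- The factor A holds what is independent of the position, such as the equality or adjacency of two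
-- threads.
equal-periodic : {A : Set} → Periodic 2 (λ m n → m ≡ n × A)
equal-periodic = banded-periodic
  (λ m n → mk⇔ (λ { (refl , x) → refl , x }) (λ { (refl , x) → refl , x }))
  (λ { (refl , _) → n≤1+n _ , n≤1+n _ })

successor-periodic : Periodic 2 (λ m n → n ≡ suc m)
successor-periodic = banded-periodic (λ m n → mk⇔ (cong suc) (cong pred))
  (λ { refl → ≤-refl , m≤n⇒m≤1+n (n≤1+n _) })

predecessor-periodic : Periodic 2 (λ m n → m ≡ suc n)
predecessor-periodic = banded-periodic (λ m n → mk⇔ (cong suc) (cong pred))
  (λ { refl → m≤n⇒m≤1+n (n≤1+n _) , ≤-refl })

-- This describes the single edge from -1 to 0 that joins the two halves of a bi-infinite path.
origin-periodic : Periodic 2 (λ m n → m ≡ 0 × n ≡ 0)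
origin-periodic = banded-periodic (λ m n → mk⇔ (λ ()) (λ ())) (λ { (refl , refl) → z≤n , z≤n })

module _ {p q : ℕ} .{{_ : NonZero q}} where

  [p*q+m]mod-q : ∀ m → (p * q + m) mod q ≡ m mod q
  [p*q+m]mod-q m = toℕ-injective (begin
    toℕ ((p * q + m) mod q)    ≡⟨ toℕ-fromℕ< (m%n<n (p * q + m) q) ⟩
    (p * q + m) % q            ≡⟨ cong (_% q) (+-comm (p * q) m) ⟩
    (m + p * q) % q            ≡⟨ [m+kn]%n≡m%n m p q ⟩
    m % q                      ≡⟨ toℕ-fromℕ< (m%n<n m q) ⟨
    toℕ (m mod q)              ∎)
    where open ≡-Reasoning

  [p*q+m]/q : ∀ m → (p * q + m) / q ≡ p + m / q
  [p*q+m]/q m = trans (+-distrib-/-∣ˡ m (divides-refl p)) (cong (_+ m / q) (m*n/n≡m p q))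

  p*q≤m⇒p≤m/q : ∀ {m} → p * q ≤ m → p ≤ m / q
  p*q≤m⇒p≤m/q p*q≤m = subst (_≤ _) (m*n/n≡m p q) (/-monoˡ-≤ q p*q≤m)

  p*q+m≤n⇒p+m/q≤n/q : ∀ {m n} → p * q + m ≤ n → p + m / q ≤ n / q
  p*q+m≤n⇒p+m/q≤n/q {m} le = subst (_≤ _) ([p*q+m]/q m) (/-monoˡ-≤ q le)

  -- Adding pq to a length preserves its remainder mod q, which is the thread, and adds p to its
  -- quotient, which is the position. Division is monotone, so the thresholds carry over.
  interleave-periodic : (R : Fin q → Fin q → Rel ℕ 0ℓ) → (∀ i j → Periodic p (R i j)) →
                        Periodic (p * q) (λ m n → R (m mod q) (n mod q) (m / q) (n / q))
  interleave-periodic R per = record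
    { diagonal = λ {m} {n} i j → ⇔-trans (diagonal (per _ _) (p*q≤m⇒p≤m/q i) (p*q≤m⇒p≤m/q j))
        (≡⇒⇔ (cong₂ _$_ (cong₂ _$_ (cong₂ R (sym ([p*q+m]mod-q m)) (sym ([p*q+m]mod-q n)))
                  (sym ([p*q+m]/q m))) (sym ([p*q+m]/q n))))
    ; right = λ {m} {n} i → ⇔-trans (right (per _ _) (p*q+m≤n⇒p+m/q≤n/q i))
        (≡⇒⇔ (cong₂ (λ j → R (m mod q) j (m / q)) (sym ([p*q+m]mod-q n)) (sym ([p*q+m]/q n))))
    ; left = λ {m} {n} i → ⇔-trans (left (per _ _) (p*q+m≤n⇒p+m/q≤n/q i))
        (≡⇒⇔ (cong₂ (λ j k → R j (n mod q) k (n / q)) (sym ([p*q+m]mod-q m)) (sym ([p*q+m]/q m))))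
    }
    where open Periodic

-- Enumeration of an infinite set in increasing order of codes

module _ {X : Set} (code : X → ℕ) (P : Pred X 0ℓ)
  (pick : ∀ k → ∃[ x ] (P x × k ≤ code x × (∀ y → P y → k ≤ code y → code x ≤ code y))) where

  enumerate : ℕ → X
  enumerate zero    = proj₁ (pick 0)
  enumerate (suc n) = proj₁ (pick (suc (code (enumerate n))))

  enumerate∈P : ∀ n → P (enumerate n)
  enumerate∈P zero    = proj₁ (proj₂ (pick 0))
  enumerate∈P (suc n) = proj₁ (proj₂ (pick (suc (code (enumerate n)))))

  enumerate-step : ∀ n → code (enumerate n) < code (enumerate (suc n))
  enumerate-step n = proj₁ (proj₂ (proj₂ (pick (suc (code (enumerate n))))))

  enumerate-mono : ∀ {m n} → m <′ n → code (enumerate m) < code (enumerate n)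
  enumerate-mono {m}             ≤′-refl       = enumerate-step m
  enumerate-mono {m} {n = suc n} (≤′-step m<n) = <-trans (enumerate-mono {m} {n} m<n) (enumerate-step n)

  n≤code : ∀ n → n ≤ code (enumerate n)
  n≤code zero    = z≤n
  n≤code (suc n) = ≤-<-trans (n≤code n) (enumerate-step n)

  enumerate-injective : Injective _≡_ _≡_ enumerate
  enumerate-injective {m} {n} eq with <-cmp m n
  ... | tri< m<n _ _ = contradiction (enumerate-mono {m} {n} (<⇒<′ m<n)) (<-irrefl (cong code eq))
  ... | tri≈ _ m≡n _ = m≡n
  ... | tri> _ _ n<m = contradiction (enumerate-mono {n} {m} (<⇒<′ n<m)) (<-irrefl (cong code (sym eq)))

  -- As long as x has not been met, the minimality of each pick keeps the enumeration from jumping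
  -- over the code of x. The codes increase strictly, so they would pass it within `suc (code x)`
  -- steps.
  enumerate-surjective : Injective _≡_ _≡_ code → ∀ {x} → P x → ∃[ n ] enumerate n ≡ x
  enumerate-surjective code-injective {x} Px = found (search (suc (code x)))
    where
    search : ∀ n → (∃[ k ] enumerate k ≡ x) ⊎ code (enumerate n) ≤ code x
    search zero = inj₂ (proj₂ (proj₂ (proj₂ (pick 0))) x Px z≤n)
    search (suc n) with search n
    ... | inj₁ hit = inj₁ hit
    ... | inj₂ le with m≤n⇒m<n∨m≡n le
    ...   | inj₁ lt = inj₂ (proj₂ (proj₂ (proj₂ (pick (suc (code (enumerate n)))))) x Px lt)
    ...   | inj₂ eq = inj₁ (n , code-injective eq)
    found : (∃[ k ] enumerate k ≡ x) ⊎ code (enumerate (suc (code x))) ≤ code x → ∃[ k ] enumerate k ≡ x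
    found (inj₁ hit) = hit
    found (inj₂ le)  = contradiction (n≤code (suc (code x))) (≤⇒≯ le)

-- Layouts of orbits in threads

HasShape-resp-⇔ : {X : Set} (f : X → Maybe X) {C D : Pred X 0ℓ} {V : Set} {_⟶_ : Rel V 0ℓ} →
                  (∀ x → C x ⇔ D x) → HasShape f C V _⟶_ → HasShape f D V _⟶_
HasShape-resp-⇔ f C⇔D (v , enum , edges) = v , record
  { injective = Enumerates.injective enum
  ; image     = λ x → ⇔-trans (⇔-sym (C⇔D x)) (Enumerates.image enum x)
  } , edges

-- A union of orbits laid out in finitely many threads; the word of length
-- i + k * threads will denote vertex i k.
record Layout {X : Set} (f : X → Maybe X) : Set where
  field
    threads    : ℕ
    vertex     : Fin threads → ℕ → X
    ≡-periodic : ∀ i j → Periodic 2 (λ k l → vertex i k ≡ vertex j l)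
    f-periodic : ∀ i j → Periodic 2 (λ k l → Edge f (vertex i k) (vertex j l))

  Covers : Pred X 0ℓ
  Covers x = ∃[ i ] ∃[ k ] vertex i k ≡ x

  field
    orbit-covered : ∀ i k {y} → Orbit f (vertex i k) y → Covers y

  closed : ∀ {x y} → Orbit f x y → Covers x → Covers y
  closed r (i , k , refl) = orbit-covered i k r

open Layout using (Covers)

module _ {X : Set} (f : X → Maybe X) where

  private
    Orb = Orbit f

  Orbit-cong : ∀ {x y} → Orb x y → ∀ z → Orb x z ⇔ Orb y z
  Orbit-cong r z = mk⇔ (symmetric _ r ◅◅_) (r ◅◅_)

  Extension : Layout f → Pred X 0ℓ → Set
  Extension T C = Σ[ U ∈ Layout f ] ((∀ {x} → Covers T x → Covers U x) × (∀ x → C x → Covers U x))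

  emptyLayout : Layout f
  emptyLayout = record
    { threads = 0 ; vertex = λ () ; ≡-periodic = λ () ; f-periodic = λ () ; orbit-covered = λ () }

  -- A layout contains the whole orbit of each of its vertices. Disjoint layouts are therefore
  -- joined by no edge, and all relations between their threads are empty.
  union : (T U : Layout f) → (∀ {x} → Covers T x → ¬ Covers U x) → Extension T (Covers U)
  union T U disjoint = record
    { threads       = T.threads + U.threads
    ; vertex        = vertex
    ; ≡-periodic    = λ i j → ≡-per (splitAt T.threads i) (splitAt T.threads j)
    ; f-periodic    = λ i j → f-per (splitAt T.threads i) (splitAt T.threads j)
    ; orbit-covered = λ i k → covered (splitAt T.threads i) k
    } , fromT , λ x → fromU
    where
    module T = Layout T
    module U = Layout U
    vertex′ : Fin T.threads ⊎ Fin U.threads → ℕ → X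
    vertex′ = [ T.vertex , U.vertex ]′
    vertex : Fin (T.threads + U.threads) → ℕ → X
    vertex i = vertex′ (splitAt T.threads i)

    ≡-per : ∀ i j → Periodic 2 (λ k l → vertex′ i k ≡ vertex′ j l)
    ≡-per (inj₁ i) (inj₁ j) = T.≡-periodic i j
    ≡-per (inj₁ i) (inj₂ j) = empty-periodic λ k l eq → disjoint (i , k , refl) (j , l , sym eq)
    ≡-per (inj₂ i) (inj₁ j) = empty-periodic λ k l eq → disjoint (j , l , refl) (i , k , eq)
    ≡-per (inj₂ i) (inj₂ j) = U.≡-periodic i j

    f-per : ∀ i j → Periodic 2 (λ k l → Edge f (vertex′ i k) (vertex′ j l))
    f-per (inj₁ i) (inj₁ j) = T.f-periodic i j
    f-per (inj₁ i) (inj₂ j) = empty-periodic λ k l e → disjoint (T.orbit-covered i k (fwd e ◅ ε)) (j , l , refl)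
    f-per (inj₂ i) (inj₁ j) = empty-periodic λ k l e → disjoint (j , l , refl) (U.orbit-covered i k (fwd e ◅ ε))
    f-per (inj₂ i) (inj₂ j) = U.f-periodic i j

    Covers′ : Pred X 0ℓ
    Covers′ x = ∃[ i ] ∃[ k ] vertex i k ≡ x
    fromT : ∀ {x} → T.Covers x → Covers′ x
    fromT (i , k , eq) = i ↑ˡ U.threads , k , trans (cong (λ s → vertex′ s k) (splitAt-↑ˡ T.threads i U.threads)) eq
    fromU : ∀ {x} → U.Covers x → Covers′ x
    fromU (i , k , eq) = T.threads ↑ʳ i , k , trans (cong (λ s → vertex′ s k) (splitAt-↑ʳ T.threads U.threads i)) eq
    covered : ∀ i k {y} → Orb (vertex′ i k) y → Covers′ y
    covered (inj₁ i) k r = fromT (T.orbit-covered i k r)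
    covered (inj₂ i) k r = fromU (U.orbit-covered i k r)

  OrbitLayout : X → Set
  OrbitLayout x = Σ[ U ∈ Layout f ] (∀ y → Orb x y ⇔ Covers U y)

  module _ {x : X} where

    private
      covered : {V : Set} {v : V → X} → Enumerates v (Orb x) → ∀ u {y} → Orb (v u) y → ∃[ w ] v w ≡ y
      covered enum u r = to (Enumerates.image enum _) (from (Enumerates.image enum _) (u , refl) ◅◅ r)

    finiteLayout : Finite (Orb x) → OrbitLayout x
    finiteLayout (n , e , enum) = record
      { threads       = n
      ; vertex        = λ i _ → e i
      ; ≡-periodic    = λ i j → constant-periodic
      ; f-periodic    = λ i j → constant-periodic
      ; orbit-covered = λ i k r → let j , eq = covered enum i r in j , 0 , eq
      } , λ y → ⇔-trans (image y) (mk⇔ (λ (i , eq) → i , 0 , eq) (λ (i , _ , eq) → i , eq))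
      where open Enumerates enum

    ℕ-layout : {_⟶_ : Rel ℕ 0ℓ} → Periodic 2 _⟶_ → HasShape f (Orb x) ℕ _⟶_ → OrbitLayout x
    ℕ-layout per (v , enum , edges) = record
      { threads       = 1
      ; vertex        = λ _ → v
      ; ≡-periodic    = λ i j → Periodic-resp-⇔ (λ k l → mk⇔ (λ eq → injective eq , tt) (cong v ∘ proj₁)) equal-periodic
      ; f-periodic    = λ i j → Periodic-resp-⇔ edges per
      ; orbit-covered = λ i k r → zero , covered enum k r
      } , λ y → ⇔-trans (image y) (mk⇔ (zero ,_) proj₂)
      where open Enumerates enum

    -- One thread holds the nonnegative half and one the negative half; along the latter positions
    -- increase against the edges.
    ℤ-layout : IsBiInfinitePath f (Orb x) → OrbitLayout x
    ℤ-layout (v , enum , edges) = record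
      { threads       = 2
      ; vertex        = λ i k → v (at i k)
      ; ≡-periodic    = λ i j → Periodic-resp-⇔ (λ k l → mk⇔ injective (cong v)) (≡-per i j)
      ; f-periodic    = λ i j → Periodic-resp-⇔ (λ k l → edges (at i k) (at j l)) (f-per i j)
      ; orbit-covered = λ i k r → split (covered enum (at i k) r)
      } , λ y → ⇔-trans (image y) (mk⇔ split (λ (i , k , eq) → at i k , eq))
      where
      open Enumerates enum
      at : Fin 2 → ℕ → ℤ
      at 0F k = pos k
      at 1F k = -[1+ k ]
      split : ∀ {y} → ∃[ u ] v u ≡ y → ∃[ i ] ∃[ k ] v (at i k) ≡ y
      split (pos k , eq)      = 0F , k , eq
      split (-[1+ k ] , eq) = 1F , k , eq
      ≡-per : ∀ i j → Periodic 2 (λ k l → at i k ≡ at j l)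
      ≡-per 0F 0F = Periodic-resp-⇔ (λ k l → mk⇔ (λ { refl → refl , tt }) (cong (at 0F) ∘ proj₁)) equal-periodic
      ≡-per 0F 1F = empty-periodic λ k l ()
      ≡-per 1F 0F = empty-periodic λ k l ()
      ≡-per 1F 1F = Periodic-resp-⇔ (λ k l → mk⇔ (λ { refl → refl , tt }) (cong (at 1F) ∘ proj₁)) equal-periodic
      f-per : ∀ i j → Periodic 2 (λ k l → at j l ≡ ℤ.suc (at i k))
      f-per 0F 0F = Periodic-resp-⇔ (λ k l → mk⇔ ℤ.+-injective (cong (at 0F))) successor-periodic
      f-per 0F 1F = empty-periodic λ k l ()
      f-per 1F 0F = Periodic-resp-⇔ (λ k l → mk⇔ (meet k l) (λ { (refl , refl) → refl })) origin-periodic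
        where
        meet : ∀ k l → pos l ≡ ℤ.suc -[1+ k ] → k ≡ 0 × l ≡ 0
        meet zero l refl = refl , refl
      f-per 1F 1F = Periodic-resp-⇔ (λ k l → mk⇔ (descend k l) (λ { refl → refl })) predecessor-periodic
        where
        descend : ∀ k l → -[1+ l ] ≡ ℤ.suc -[1+ k ] → k ≡ suc l
        descend (suc k) l refl = refl

  -- Thread i collects the i-th vertices of all the orbits. Different positions belong to different
  -- orbits, so equalities and edges occur only at equal positions and there follow the common
  -- shape.
  familyLayout : ∀ {n} {_⟶_ : Rel (Fin n) 0ℓ} (b : ℕ → X) →
                 (∀ {k l} → Orb (b k) (b l) → k ≡ l) → (∀ k → HasShape f (Orb (b k)) (Fin n) _⟶_) →
                 Σ[ U ∈ Layout f ] (∀ y → Covers U y ⇔ (∃[ k ] Orb (b k) y))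
  familyLayout {n} {_⟶_} b independent shape = record
    { threads       = n
    ; vertex        = vertex
    ; ≡-periodic    = λ i j → Periodic-resp-⇔ (λ k l → mk⇔ (≡-to i j k l) (λ { (refl , refl) → refl })) equal-periodic
    ; f-periodic    = λ i j → Periodic-resp-⇔ (λ k l → mk⇔ (f-to i j k l) (λ { (refl , i⟶j) → from (edges k i j) i⟶j })) equal-periodic
    ; orbit-covered = λ i k r → covered k (inOrbit i k ◅◅ r)
    } , λ y → mk⇔ (λ { (i , k , refl) → k , inOrbit i k }) (λ (k , r) → covered k r)
    where
    vertex : Fin n → ℕ → X
    vertex i k = proj₁ (shape k) i
    module Enum k = Enumerates (proj₁ (proj₂ (shape k)))
    edges : ∀ k i j → Edge f (vertex i k) (vertex j k) ⇔ (i ⟶ j)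
    edges k = proj₂ (proj₂ (shape k))
    inOrbit : ∀ i k → Orb (b k) (vertex i k)
    inOrbit i k = from (Enum.image k _) (i , refl)
    covered : ∀ k {y} → Orb (b k) y → ∃[ i ] ∃[ k ] vertex i k ≡ y
    covered k r = let i , eq = to (Enum.image k _) r in i , k , eq
    ≡-to : ∀ i j k l → vertex i k ≡ vertex j l → k ≡ l × i ≡ j
    ≡-to i j k l eq with refl ← independent (subst (Orb (b k)) eq (inOrbit i k) ◅◅ symmetric _ (inOrbit j l)) =
      refl , Enum.injective k eq
    f-to : ∀ i j k l → Edge f (vertex i k) (vertex j l) → k ≡ l × (i ⟶ j)
    f-to i j k l e with refl ← independent (inOrbit i k ◅◅ fwd e ◅ symmetric _ (inOrbit j l)) =
      refl , to (edges k i j) e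

  CycleOrPath : ℕ → Pred X 0ℓ
  CycleOrPath n x = HasShape f (Orb x) (Fin (suc n)) (λ i j → toℕ j ≡ suc (toℕ i) % suc n) ⊎
                    HasShape f (Orb x) (Fin (suc n)) (λ i j → toℕ j ≡ suc (toℕ i))

  module _ (em : ExcludedMiddle 0ℓ) where

    addOrbit : (∀ x → OrbitLayout x) → ∀ T x → Extension T (_≡ x)
    addOrbit orbitLayout T x with em {Covers T x}
    ... | yes covered = T , (λ c → c) , λ { _ refl → covered }
    ... | no ¬covered =
      let U , orbit⇔ = orbitLayout x
          V , T⊆V , U⊆V = union T U λ {y} cT cU → ¬covered (Layout.closed T (symmetric _ (from (orbit⇔ y) cU)) cT)
      in V , T⊆V , λ { _ refl → U⊆V x (to (orbit⇔ x) ε) }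

    addOrbits : (∀ x → OrbitLayout x) → ∀ xs T → Extension T (_∈ xs)
    addOrbits orbitLayout []       T = T , (λ c → c) , λ _ ()
    addOrbits orbitLayout (x ∷ xs) T =
      let U , T⊆U , x∈U  = addOrbit orbitLayout T x
          V , U⊆V , xs⊆V = addOrbits orbitLayout xs U
      in V , U⊆V ∘ T⊆U , λ { y (here y≡x) → U⊆V (x∈U y y≡x) ; y (there y∈xs) → xs⊆V y y∈xs }

    module _ (code : X → ℕ) (code-injective : Injective _≡_ _≡_ code) (orbitLayout : ∀ x → OrbitLayout x) where

      module _ {n : ℕ} (_⟶_ : Rel (Fin n) 0ℓ) (T : Layout f) where

        private
          Shape : Pred X 0ℓ
          Shape x = HasShape f (Orb x) (Fin n) _⟶_

        -- A transversal of the orbits of this shape still to be laid out; least codes single out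
        -- the representatives.
        Base : Pred X 0ℓ
        Base x = Shape x × (∀ y → Orb x y → code x ≤ code y) × ¬ Covers T x

        orbit-base : ∀ {x} → Shape x → ¬ Covers T x → ∃[ y ] (Orb x y × Base y)
        orbit-base {x} shape ¬covered
          with _ , (y , r , refl) , minimal ← least em {λ c → ∃[ y ] (Orb x y × code y ≡ c)} (code x , x , ε , refl)
          = y , r , HasShape-resp-⇔ f (Orbit-cong r) shape , (λ z r′ → minimal (code z) (z , r ◅◅ r′ , refl)) ,
            λ covered → ¬covered (Layout.closed T (symmetric _ r) covered)

        base⇒extension : (U : Layout f) → (∀ {x} → Covers T x → Covers U x) → (∀ x → Base x → Covers U x) →
                         Extension T Shape
        base⇒extension U T⊆U base⊆U = U , T⊆U , λ x shape → cover x shape em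
          where
          cover : ∀ x → Shape x → Dec (Covers T x) → Covers U x
          cover x shape (yes covered) = T⊆U covered
          cover x shape (no ¬covered) with y , r , base ← orbit-base shape ¬covered =
            Layout.closed U (symmetric _ r) (base⊆U y base)

        base-independent : ∀ {x y} → Base x → Base y → Orb x y → x ≡ y
        base-independent (_ , x-least , _) (_ , y-least , _) r =
          code-injective (≤-antisym (x-least _ r) (y-least _ (symmetric _ r)))

        pickBase : Infinite Base → ∀ k → ∃[ x ] (Base x × k ≤ code x × (∀ y → Base y → k ≤ code y → code x ≤ code y))
        pickBase infinite k
          with x₀ , base₀ , k≤x₀ ← infinite⇒unbounded em code code-injective infinite k
          with _ , (x , base , k≤x , refl) , minimal ←
                 least em {λ c → ∃[ x ] (Base x × k ≤ code x × code x ≡ c)} (code x₀ , x₀ , base₀ , k≤x₀ , refl)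
          = x , base , k≤x , λ y base′ k≤y → minimal (code y) (y , base′ , k≤y , refl)

        addFinitelyMany : Finite Base → Extension T Shape
        addFinitelyMany (m , e , enum) =
          let U , T⊆U , e⊆U = addOrbits orbitLayout (tabulate e) T
          in base⇒extension U T⊆U λ x base →
            let i , eq = to (Enumerates.image enum x) base
            in e⊆U x (subst (_∈ tabulate e) eq (∈-tabulate⁺ i))

        addInfinitelyMany : (b : ℕ → X) → Injective _≡_ _≡_ b → (∀ k → Base (b k)) →
                            (∀ {x} → Base x → ∃[ k ] b k ≡ x) → Extension T Shape
        addInfinitelyMany b b-injective b-base b-surjective =
          let U , family⇔ = familyLayout b (λ {k} {l} r → b-injective (base-independent (b-base k) (b-base l) r)) (proj₁ ∘ b-base)
              V , T⊆V , U⊆V = union T U λ {x} cT cU →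
                let k , r = to (family⇔ x) cU in proj₂ (proj₂ (b-base k)) (Layout.closed T (symmetric _ r) cT)
          in base⇒extension V T⊆V λ x base →
            let k , eq = b-surjective base in U⊆V x (from (family⇔ x) (k , subst (Orb (b k)) eq ε))

        -- Finitely many missing orbits are added singly; infinitely many are indexed by ℕ through
        -- their representatives and form one family.
        addShape : Extension T Shape
        addShape = decide em
          where
          decide : Dec (Finite Base) → Extension T Shape
          decide (yes finite)  = addFinitelyMany finite
          decide (no infinite) = addInfinitelyMany (enumerate code Base pick) (enumerate-injective code Base pick)
            (enumerate∈P code Base pick) (enumerate-surjective code Base pick code-injective)
            where pick = pickBase infinite

      addShapes : ∀ N T → Extension T (λ x → ∃[ n ] (n < N × CycleOrPath n x))
      addShapes zero    T = T , (λ c → c) , λ { _ (_ , () , _) }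
      addShapes (suc N) T =
        let U , T⊆U , old    = addShapes N T
            V , U⊆V , cycles = addShape (λ i j → toℕ j ≡ suc (toℕ i) % suc N) U
            W , V⊆W , paths  = addShape (λ i j → toℕ j ≡ suc (toℕ i)) V
            cover : ∀ x → ∃[ n ] (n < suc N × CycleOrPath n x) → Covers W x
            cover = λ { x (n , n<1+N , shape) → [ (λ n<N → V⊆W (U⊆V (old x (n , n<N , shape)))) ,
                          (λ { refl → [ V⊆W ∘ cycles x , paths x ]′ shape }) ]′ (m<1+n⇒m<n∨m≡n n<1+N) }
        in W , V⊆W ∘ U⊆V ∘ T⊆U , cover

    constant-regular : {A B : Set} → Regular {A} (λ _ → B)
    constant-regular {B = B} = finiteIndex⇒regular em {N = 1} (λ _ → zero) (λ _ _ → tt) tt (λ _ → B)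
      (λ _ _ → refl) (λ _ b → b)

    layout⇒presentable : (T : Layout f) → (∀ x → Covers T x) → UnaryFAPresentable f
    -- Here X is empty and is presented by the empty language; the general case divides by the
    -- number of threads.
    layout⇒presentable record { threads = zero } covers = record
      { L            = λ _ → ⊥
      ; L-regular    = constant-regular
      ; φ            = λ _ l → ⊥-elim-irr l
      ; φ-surjective = λ x → contradiction (proj₁ (covers x)) λ ()
      ; ≡-regular    = periodic⇒regular em (s≤s z≤n) (constant-periodic {1} {⊥}) λ u v → mk⇔ proj₁ ⊥-elim
      ; f-regular    = periodic⇒regular em (s≤s z≤n) (constant-periodic {1} {⊥}) λ u v → mk⇔ proj₁ ⊥-elim
      }
    layout⇒presentable T@record { threads = q@(suc _) } covers = record
      { L            = λ _ → ⊤
      ; L-regular    = constant-regular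
      ; φ            = λ u _ → name (length u)
      ; φ-surjective = λ x → let i , k , eq = covers x in
          a^ (toℕ i + k * q) , tt , trans (cong name (length-replicate (toℕ i + k * q))) (trans (name-at i k) eq)
      ; ≡-regular    = periodic⇒regular em (s≤s z≤n) (interleave-periodic {2} {q} _ ≡-periodic)
                         λ u v → mk⇔ (proj₂ ∘ proj₂) (λ eq → tt , tt , eq)
      ; f-regular    = periodic⇒regular em (s≤s z≤n) (interleave-periodic {2} {q} _ f-periodic)
                         λ u v → mk⇔ (proj₂ ∘ proj₂) (λ e → tt , tt , e)
      }
      where
      open Layout T using (vertex; ≡-periodic; f-periodic)
      name : ℕ → X
      name m = vertex (m mod q) (m / q)
      name-at : ∀ i k → name (toℕ i + k * q) ≡ vertex i k
      name-at i k = cong₂ vertex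
        (toℕ-injective (trans (toℕ-fromℕ< (m%n<n (toℕ i + k * q) q)) (trans ([m+kn]%n≡m%n (toℕ i) k q) (m<n⇒m%n≡m (toℕ<n i)))))
        (trans (cong (_/ q) (+-comm (toℕ i) (k * q)))
          (trans ([p*q+m]/q {k} {q} (toℕ i)) (trans (cong (_+_ k) (m<n⇒m/n≡0 (toℕ<n i))) (+-identityʳ k))))

bounded×finitelyMany⇒presentable : ExcludedMiddle 0ℓ → {X : Set} (code : X → ℕ) → Injective _≡_ _≡_ code →
  (f : X → Maybe X) → PartialInjective f →
  FiniteOrbitsBounded f → FinitelyManyInfiniteOrbits f → UnaryFAPresentable f
bounded×finitelyMany⇒presentable em code code-injective f f-injective (N , bounded) (xs , meets) =
  -- The infinite orbits come first, through their representatives; the finite ones follow, shape by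
  -- shape.
  let U , _ , xs⊆U        = addOrbits f em orbitLayout xs (emptyLayout f)
      V , U⊆V , bounded⊆V = addShapes f em code code-injective orbitLayout N U
      cover : ∀ x → Dec (Finite (Orbit f x)) → Covers V x
      cover = λ { x (yes finite) → bounded⊆V x (small x (finite⇒cycle⊎path f f-injective em x finite))
                ; x (no infinite) → let y , y∈xs , r = find (meets x infinite)
                                    in Layout.closed V (symmetric _ r) (U⊆V (xs⊆U y y∈xs)) }
  in layout⇒presentable f em V λ x → cover x em
  where
  orbitLayout : ∀ x → OrbitLayout f x
  orbitLayout x with em {Finite (Orbit f x)}
  ... | yes finite = finiteLayout f finite
  ... | no infinite with infinite⇒path f f-injective em x infinite
  ...   | inj₁ outward       = ℕ-layout f successor-periodic outward
  ...   | inj₂ (inj₁ inward) = ℕ-layout f predecessor-periodic inward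
  ...   | inj₂ (inj₂ bi)     = ℤ-layout f bi

  small : ∀ x → IsDirectedCycle f (Orbit f x) ⊎ IsFiniteDirectedPath f (Orbit f x) →
          ∃[ n ] (n < N × CycleOrPath f n x)
  -- Shape n has n + 1 vertices, so the bound on orbit sizes reads n < N.
  small x (inj₁ (n , shape@(v , enum , _))) = n , bounded x (suc n) (v , enum) , inj₁ shape
  small x (inj₂ (n , shape@(v , enum , _))) = n , bounded x (suc n) (v , enum) , inj₂ shape

-- The two characterisations

total⇒successor : ∀ {X V : Set} (f : X → X) {x} {_⟶_ : Rel V 0ℓ} →
                  HasShape (just ∘ f) (Orbit (just ∘ f) x) V _⟶_ → ∀ u → ∃[ v ] (u ⟶ v)
-- The image of a vertex lies in the same orbit, hence is a vertex too. This rules out finite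
-- directed paths and inward infinite paths, each of which has a final vertex.
total⇒successor f (vertex , enum , edges) u
  with v , eq ← to (Enumerates.image enum (f (vertex u))) (from (Enumerates.image enum (vertex u)) (u , refl) ◅◅ fwd refl ◅ ε)
  = v , to (edges u v) (cong just (sym eq))

theorem7p6 : ExcludedMiddle 0ℓ → (X : Set) → X ↣ ℕ →
    ((f : X → X) → Injective _≡_ _≡_ f →
    UnaryFAPresentable (just ∘ f) ⇔ (Condition1 (just ∘ f) × Condition2 (just ∘ f)))
    ×
    ((f : X → Maybe X) → PartialInjective f →
    UnaryFAPresentable f ⇔ (Condition3 f × Condition4 f))
theorem7p6 em X X↣ℕ = total , partial
  where
  present : (f : X → Maybe X) → PartialInjective f →
            FiniteOrbitsBounded f → FinitelyManyInfiniteOrbits f → UnaryFAPresentable f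
  present = bounded×finitelyMany⇒presentable em (Injection.to X↣ℕ) (Injection.injective X↣ℕ)

  partial : (f : X → Maybe X) → PartialInjective f → UnaryFAPresentable f ⇔ (Condition3 f × Condition4 f)
  partial f f-injective = mk⇔
    (λ presentation →
      let bounded , finitelyMany = presentable⇒bounded×finitelyMany em f f-injective presentation
      in (bounded , finite⇒cycle⊎path f f-injective em) , (finitelyMany , infinite⇒path f f-injective em))
    (λ ((bounded , _) , (finitelyMany , _)) → present f f-injective bounded finitelyMany)

  total : (f : X → X) → Injective _≡_ _≡_ f →
          UnaryFAPresentable (just ∘ f) ⇔ (Condition1 (just ∘ f) × Condition2 (just ∘ f))
  total f f-injective = mk⇔
    (λ presentation →
      let bounded , finitelyMany = presentable⇒bounded×finitelyMany em (just ∘ f) partial-injective presentation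
      in (bounded , cycle) , (finitelyMany , path))
    (λ ((bounded , _) , (finitelyMany , _)) → present (just ∘ f) partial-injective bounded finitelyMany)
    where
    partial-injective : PartialInjective (just ∘ f)
    partial-injective e e′ = f-injective (just-injective (trans e (sym e′)))

    cycle : ∀ x → Finite (Orbit (just ∘ f) x) → IsDirectedCycle (just ∘ f) (Orbit (just ∘ f) x)
    cycle x finite with finite⇒cycle⊎path (just ∘ f) partial-injective em x finite
    ... | inj₁ isCycle = isCycle
    ... | inj₂ (n , shape) with j , eq ← total⇒successor f shape (fromℕ n) =
      contradiction (subst (_< suc n) (trans eq (cong suc (toℕ-fromℕ n))) (toℕ<n j)) (n≮n (suc n))

    path : ∀ x → Infinite (Orbit (just ∘ f) x) →
           IsOutwardInfinitePath (just ∘ f) (Orbit (just ∘ f) x) ⊎ IsBiInfinitePath (just ∘ f) (Orbit (just ∘ f) x)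
    path x infinite with infinite⇒path (just ∘ f) partial-injective em x infinite
    ... | inj₁ outward        = inj₁ outward
    ... | inj₂ (inj₁ inward)  with () ← proj₂ (total⇒successor f inward 0)
    ... | inj₂ (inj₂ bi)      = inj₂ bi
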